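{- Let $(G,\sigma)$ be a flow-admissible signed cubic graph. If $(G,\sigma)$ contains no long barbells, then $(G,\sigma)$ admits a nowhere-zero $\mathbb{Z}_4$-flow if and only if $G$ is $3$-edge-colorable.
   Context: A signed graph $(G,\sigma)$ is a graph $G$ with a signature $\sigma:E(G)\to\{ -1,+1\}$; edges with $\sigma(e)=-1$ are negative. A circuit is balanced if it contains an even number of negative edges and unbalanced otherwise. A long barbell is the union of two vertex-disjoint unbalanced circuits together with a path meeting the circuits only at its two ends. Each edge $e=uv$ consists of half-edges $h_e^u$ and $h_e^v$; $H(v)$ is the set of half-edges at $v$. An orientation is a map $\tau$ from half-edges to $\{\pm1\}$ with $\tau(h_e^u)\tau(h_e^v)=-\sigma(e)$ for each edge $e=uv$; $\partial(\tau,f)(v)=\sum_{h\in H(v)}\tau(h)f(e_h)$ with $e_h$ the edge containing $h$. A nowhere-zero $\mathbb{Z}_4$-flow is an orientation $\tau$ with $f:E(G)\to\mathbb{Z}_4\setminus\{0\}$ such that $\partial(\tau,f)(v)\equiv 0\pmod 4$ for all $v$. A nowhere-zero $k$-flow is an orientation with $f:E(G)\to\mathbb{Z}$, $1\le|f(e)|\le k-1$, and $\partial(\tau,f)\equiv 0$; $(G,\sigma)$ is flow-admissible if it admits a nowhere-zero $k$-flow for some integer $k$. -}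

module Defs where

open import Data.Nat as ℕ using (ℕ; zero; suc; _∸_; _%_)
open import Data.Integer as ℤ using (ℤ; +_; 0ℤ; -1ℤ; 1ℤ; ∣_∣)
open import Data.Integer.Divisibility as ℤD using ()
open import Data.Fin as Fin using (Fin; zero; suc; toℕ; inject₁; fromℕ; _≟_)
open import Data.Product using (Σ; ∃; ∃-syntax; _×_; _,_)
open import Data.Bool using (if_then_else_)
open import Relation.Nullary using (¬_)
open import Relation.Nullary.Decidable using (⌊_⌋)
open import Relation.Binary.PropositionalEquality using (_≡_; _≢_)
open import Function.Definitions using (Injective)

Σℕ : ∀ {k} → (Fin k → ℕ) → ℕ
Σℕ {zero}  f = 0
Σℕ {suc k} f = f zero ℕ.+ Σℕ (λ i → f (suc i))

Σℤ : ∀ {k} → (Fin k → ℤ) → ℤ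
Σℤ {zero}  f = 0ℤ
Σℤ {suc k} f = f zero ℤ.+ Σℤ (λ i → f (suc i))

-- Finite multigraphs (loops and parallel edges allowed), given by
-- half-edges: edge e has half-edges (e , 0) and (e , 1); end e i is
-- the vertex at which half-edge (e , i) lies.

record Graph : Set where
  field
    nV  : ℕ
    nE  : ℕ
    end : Fin nE → Fin 2 → Fin nV
open Graph public

Joins : (G : Graph) → Fin (nE G) → Fin (nV G) → Fin (nV G) → Set
Joins G e u v = (end G e zero ≡ u × end G e (suc zero) ≡ v)
              Data.Sum.⊎ (end G e zero ≡ v × end G e (suc zero) ≡ u)
  where import Data.Sum

-- degree = number of half-edges at v (a loop counts twice)
degree : (G : Graph) → Fin (nV G) → ℕ
degree G v = Σℕ (λ e → Σℕ (λ i → if ⌊ end G e i ≟ v ⌋ then 1 else 0))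

Cubic : Graph → Set
Cubic G = ∀ v → degree G v ≡ 3

data Sign : Set where
  pos neg : Sign

_·_ : Sign → Sign → Sign
pos · s = s
neg · pos = neg
neg · neg = pos

negate : Sign → Sign
negate pos = neg
negate neg = pos

toℤ : Sign → ℤ
toℤ pos = 1ℤ
toℤ neg = -1ℤ

Signature : Graph → Set
Signature G = Fin (nE G) → Sign

HalfSign : Graph → Set
HalfSign G = Fin (nE G) → Fin 2 → Sign

IsOrientation : (G : Graph) → Signature G → HalfSign G → Set
IsOrientation G σ τ = ∀ e → τ e zero · τ e (suc zero) ≡ negate (σ e)

∂ : (G : Graph) → HalfSign G → (Fin (nE G) → ℤ) → Fin (nV G) → ℤ
∂ G τ f v = Σℤ (λ e → Σℤ (λ i →
  if ⌊ end G e i ≟ v ⌋ then toℤ (τ e i) ℤ.* f e else 0ℤ))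

HasNZFlow : (G : Graph) → Signature G → ℕ → Set
HasNZFlow G σ k =
  ∃[ τ ] ∃[ f ] (IsOrientation G σ τ
     × (∀ e → 1 ℕ.≤ ∣ f e ∣ × ∣ f e ∣ ℕ.≤ k ∸ 1)
     × (∀ v → ∂ G τ f v ≡ 0ℤ))

FlowAdmissible : (G : Graph) → Signature G → Set
FlowAdmissible G σ = ∃[ k ] HasNZFlow G σ k

HasNZℤ₄Flow : (G : Graph) → Signature G → Set
HasNZℤ₄Flow G σ =
  Σ (HalfSign G) λ τ → Σ (Fin (nE G) → Fin 4) λ f →
    IsOrientation G σ τ
    × (∀ e → f e ≢ zero)
    × (∀ v → (+ 4) ℤD.∣ ∂ G τ (λ e → + toℕ (f e)) v)

-- Proper 3-edge-colouring: distinct half-edges at a common vertex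
-- belong to edges of different colours (so a loop is never colourable).

ThreeEdgeColorable : Graph → Set
ThreeEdgeColorable G =
  Σ (Fin (nE G) → Fin 3) λ c →
    ∀ e e' i i' → ¬ (e ≡ e' × i ≡ i') → end G e i ≡ end G e' i' → c e ≢ c e'

record Circuit (G : Graph) : Set where
  field
    len     : ℕ
    len≥1   : 1 ℕ.≤ len
    vert    : Fin (suc len) → Fin (nV G)
    edge    : Fin len → Fin (nE G)
    closed  : vert zero ≡ vert (fromℕ len)
    vinj    : Injective _≡_ _≡_ (λ i → vert (inject₁ i))
    einj    : Injective _≡_ _≡_ edge
    joins   : ∀ i → Joins G (edge i) (vert (inject₁ i)) (vert (suc i))
open Circuit public

OnCircuit : ∀ {G} → Circuit G → Fin (nV G) → Set
OnCircuit C v = ∃[ i ] vert C (inject₁ i) ≡ v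

negCount : ∀ {G} → Signature G → Circuit G → ℕ
negCount σ C = Σℕ (λ i → isNeg (σ (edge C i)))
  where
  isNeg : Sign → ℕ
  isNeg pos = 0
  isNeg neg = 1

Unbalanced : ∀ {G} → Signature G → Circuit G → Set
Unbalanced σ C = negCount σ C % 2 ≡ 1

record Path (G : Graph) : Set where
  field
    plen  : ℕ
    pvert : Fin (suc plen) → Fin (nV G)
    pedge : Fin plen → Fin (nE G)
    pvinj : Injective _≡_ _≡_ pvert
    peinj : Injective _≡_ _≡_ pedge
    pjoin : ∀ i → Joins G (pedge i) (pvert (inject₁ i)) (pvert (suc i))
open Path public

record LongBarbell (G : Graph) (σ : Signature G) : Set where
  field
    C₁ C₂  : Circuit G
    unb₁   : Unbalanced σ C₁
    unb₂   : Unbalanced σ C₂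
    disj   : ∀ v → OnCircuit C₁ v → ¬ OnCircuit C₂ v
    P      : Path G
    start  : OnCircuit C₁ (pvert P zero)
    stop   : OnCircuit C₂ (pvert P (fromℕ (plen P)))
    inner₁ : ∀ i → i ≢ zero → ¬ OnCircuit C₁ (pvert P i)
    inner₂ : ∀ i → i ≢ fromℕ (plen P) → ¬ OnCircuit C₂ (pvert P i)

{-# OPTIONS --safe #-}

-- Everything is linear algebra over 𝔽₂ on subgraphs. A potential along a spanning forest shows
-- that a system p u + p v = t e on the edges of A is either solvable or violated by an even edge
-- set Y ⊆ A of odd t-weight. An even edge set with an odd number of negative edges contains an
-- unbalanced circuit; two disjoint such sets in one component of a cubic graph give vertex-disjoint
-- circuits, hence a long barbell. So, without long barbells, an even edge set within a component
-- whose number of negative edges is even has no even subset with an odd number of them.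
--
-- A ℤ₄-flow takes odd values on a 2-factor X, on whose circuits the length and the number of
-- negative edges have the same parity. A circuit of X of odd length would thus be an odd subset,
-- so X splits into two colour classes, the edges of value 2 being the third. Conversely, for a
-- 3-edge-colouring, the numbers of negative edges in the three pairs of colour classes within a
-- component add up to an even number, so some pair has an even number of them. The circuits of
-- this pair have even length and are balanced, hence carry the values ± 1 of a flow whose value
-- is 2 on the third class.
module Submission where

open import Defs
open import Algebra.Bundles using (CommutativeMonoid; CommutativeRing)
open import Data.Bool as Bool using (Bool; true; false; if_then_else_; _∧_; _xor_; not)
open import Data.Bool.Properties
  using ( xor-∧-commutativeRing; xor-same; xor-comm; xor-assoc; xor-identityʳ; ∧-comm; ∧-zeroʳ
        ; ∧-identityʳ; ∧-distribˡ-xor; ∧-distribʳ-xor; ¬-not )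
open import Data.Bool.Solver using (module xor-∧-Solver)
open import Data.Empty using (⊥)
open import Data.Fin using (Fin; zero; suc; _≟_; inject₁; fromℕ; opposite; toℕ)
open import Data.Fin.Patterns using (0F; 1F; 2F; 3F)
open import Data.Fin.Properties using (inject₁-injective; fromℕ≢inject₁; any?; all?)
open import Data.Integer as ℤ using (ℤ; +_; ∣_∣)
import Data.Integer.Properties as ℤ
open import Data.List
  using (List; []; _∷_; _++_; allFin; cartesianProduct; filter; foldr; map; length; tabulate)
open import Data.List.Membership.Propositional using (_∈_)
open import Data.List.Membership.Propositional.Properties
  using (∈-filter⁺; ∈-filter⁻; ∈-cartesianProduct⁺; ∈-allFin)
open import Data.List.Relation.Binary.Permutation.Propositional
  using (_↭_; ↭⇒↭ₛ; ↭-refl; ↭-sym; ↭-trans; ↭-swap; ↭-prep)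
open import Data.List.Relation.Binary.Permutation.Propositional.Properties using (∈-resp-↭)
import Data.List.Relation.Binary.Permutation.Setoid.Properties as ↭ₛ
open import Data.List.Relation.Unary.All using ([]; _∷_)
open import Data.List.Relation.Unary.AllPairs using ([]; _∷_)
open import Data.List.Relation.Unary.Any using (here; there)
import Data.List.Relation.Unary.Unique.Propositional.Properties as Unique
open import Data.Nat as ℕ using (ℕ; zero; suc; _%_)
import Data.Nat.Divisibility as ℕ
open import Data.Nat.DivMod using (%-distribˡ-+)
import Data.Nat.Properties as ℕ
open import Data.Product using (∃-syntax; Σ-syntax; _×_; _,_; proj₁; proj₂)
open import Data.Sum using (_⊎_; inj₁; inj₂)
open import Data.Unit using (⊤; tt)
open import Function using (_∘_; id; const)
open import Function.Bundles using (_⇔_; mk⇔)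
open import Function.Definitions using (Injective)
open import Level using (0ℓ)
open import Relation.Binary.PropositionalEquality as ≡
  using (_≡_; _≢_; refl; sym; trans; cong; cong₂; subst; subst₂; module ≡-Reasoning)
open import Relation.Nullary using (¬_; Dec; yes; no; contradiction)
open import Relation.Nullary.Decidable
  using (⌊_⌋; _×-dec_; _⊎-dec_; _→-dec_; ¬?; decidable-stable; from-yes; map′)

-- Sums over half-edges

module Sums (M : CommutativeMonoid 0ℓ 0ℓ) where
  open CommutativeMonoid M renaming (refl to ≈-refl; sym to ≈-sym; trans to ≈-trans)
  open import Algebra.Properties.CommutativeMonoid.Sum M public
  open import Relation.Binary.Reasoning.Setoid setoid

  when : Bool → Carrier → Carrier
  when b x = if b then x else ε

  when-cong : ∀ {A : Set} (d : Dec A) {x y} → (A → x ≈ y) → when ⌊ d ⌋ x ≈ when ⌊ d ⌋ y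
  when-cong (yes a) x≈y = x≈y a
  when-cong (no _)  x≈y = ≈-refl

  sum-cong : ∀ {n} {f g : Fin n → Carrier} → (∀ i → f i ≈ g i) → sum f ≈ sum g
  sum-cong = sum-cong-≋

  sum-ε : ∀ {n} {f : Fin n → Carrier} → (∀ i → f i ≈ ε) → sum f ≈ ε
  sum-ε {n} f≈ε = ≈-trans (sum-cong f≈ε) (sum-replicate-zero n)

  sum-point : ∀ {n} (j : Fin n) (x : Carrier) → sum (λ i → when ⌊ j ≟ i ⌋ x) ≈ x
  sum-point {suc n} zero x = ≈-trans (∙-congˡ (sum-replicate-zero n)) (identityʳ x)
  sum-point (suc j) x = ≈-trans (identityˡ _) (≈-trans (sum-cong shift) (sum-point j x))
    where
    shift : ∀ i → when ⌊ suc j ≟ suc i ⌋ x ≈ when ⌊ j ≟ i ⌋ x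
    shift i with j ≟ i
    ... | yes _ = ≈-refl
    ... | no _  = ≈-refl

  listSum : ∀ {A : Set} → (A → Carrier) → List A → Carrier
  listSum f = foldr (λ x s → f x ∙ s) ε

  sum-allFin : ∀ {n} {A : Set} (f : A → Carrier) (g : Fin n → A) → listSum f (tabulate g) ≈ sum (f ∘ g)
  sum-allFin {zero}  f g = ≈-refl
  sum-allFin {suc n} f g = ∙-congˡ (sum-allFin f (g ∘ suc))

  listSum-++ : ∀ {A : Set} (f : A → Carrier) xs ys → listSum f (xs ++ ys) ≈ listSum f xs ∙ listSum f ys
  listSum-++ f []       ys = ≈-sym (identityˡ _)
  listSum-++ f (x ∷ xs) ys = ≈-trans (∙-congˡ (listSum-++ f xs ys)) (≈-sym (assoc _ _ _))

  listSum-map : ∀ {A B : Set} (f : B → Carrier) (g : A → B) xs → listSum f (map g xs) ≈ listSum (f ∘ g) xs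
  listSum-map f g []       = ≈-refl
  listSum-map f g (x ∷ xs) = ∙-congˡ (listSum-map f g xs)

  listSum-cong : ∀ {A : Set} {f g : A → Carrier} → (∀ x → f x ≈ g x) → ∀ xs → listSum f xs ≈ listSum g xs
  listSum-cong f≈g []       = ≈-refl
  listSum-cong f≈g (x ∷ xs) = ∙-cong (f≈g x) (listSum-cong f≈g xs)

  listSum-product : ∀ {A B : Set} (f : A × B → Carrier) xs ys →
    listSum f (cartesianProduct xs ys) ≈ listSum (λ x → listSum (λ y → f (x , y)) ys) xs
  listSum-product f []       ys = ≈-refl
  listSum-product f (x ∷ xs) ys = ≈-trans
    (listSum-++ f (map (x ,_) ys) (cartesianProduct xs ys))
    (∙-cong (listSum-map f (x ,_) ys) (listSum-product f xs ys))

  listSum-filter : ∀ {A : Set} {P : A → Set} (P? : ∀ x → Dec (P x)) (f : A → Carrier) xs →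
    listSum f (filter P? xs) ≈ listSum (λ x → when ⌊ P? x ⌋ (f x)) xs
  listSum-filter P? f [] = ≈-refl
  listSum-filter P? f (x ∷ xs) with P? x
  ... | yes _ = ∙-congˡ (listSum-filter P? f xs)
  ... | no _  = ≈-trans (listSum-filter P? f xs) (≈-sym (identityˡ _))

  listSum-↭ : ∀ {A : Set} (f : A → Carrier) {xs ys} → xs ↭ ys → listSum f xs ≈ listSum f ys
  listSum-↭ f _↭_.refl         = ≈-refl
  listSum-↭ f (_↭_.prep x p)   = ∙-congˡ (listSum-↭ f p)
  listSum-↭ f (_↭_.swap x y p) = ≈-trans (≈-sym (assoc _ _ _))
    (≈-trans (∙-cong (comm _ _) (listSum-↭ f p)) (assoc _ _ _))
  listSum-↭ f (_↭_.trans p q)  = ≈-trans (listSum-↭ f p) (listSum-↭ f q)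

  module _ (G : Graph) where

    -- The common shape of `degree` and `∂`, over any commutative monoid: counts in ℕ, flows in ℤ
    -- and parities in `Bool` are all instances.
    at : Fin (nV G) → (Fin (nE G) → Fin 2 → Carrier) → Carrier
    at v φ = sum λ e → sum λ i → when ⌊ end G e i ≟ v ⌋ (φ e i)

    at-cong : ∀ v {φ ψ} → (∀ e i → end G e i ≡ v → φ e i ≈ ψ e i) → at v φ ≈ at v ψ
    at-cong v φ≈ψ = sum-cong λ e → sum-cong λ i → when-cong (end G e i ≟ v) (φ≈ψ e i)

    at-∙ : ∀ v φ ψ → at v (λ e i → φ e i ∙ ψ e i) ≈ at v φ ∙ at v ψ
    at-∙ v φ ψ = ≈-trans
      (sum-cong λ e → ≈-trans (sum-cong λ i → split ⌊ end G e i ≟ v ⌋ {φ e i} {ψ e i})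
        (∑-distrib-+ (λ i → when ⌊ end G e i ≟ v ⌋ (φ e i)) (λ i → when ⌊ end G e i ≟ v ⌋ (ψ e i))))
      (∑-distrib-+ (λ e → sum λ i → when ⌊ end G e i ≟ v ⌋ (φ e i)) _)
      where
      split : ∀ b {x y} → when b (x ∙ y) ≈ when b x ∙ when b y
      split true  = ≈-refl
      split false = ≈-sym (identityˡ ε)

    -- Double counting: after exchanging the sums, each half-edge is counted at exactly one vertex.
    -- Loops are no exception, as they count twice on both sides.
    handshake : ∀ φ → sum (λ v → at v φ) ≈ sum (λ e → φ e zero ∙ φ e (suc zero))
    handshake φ = begin
      sum (λ v → sum λ e → sum λ i → when ⌊ end G e i ≟ v ⌋ (φ e i))
        ≈⟨ ∑-comm (λ v e → sum λ i → when ⌊ end G e i ≟ v ⌋ (φ e i)) ⟩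
      sum (λ e → sum λ v → sum λ i → when ⌊ end G e i ≟ v ⌋ (φ e i))
        ≈⟨ sum-cong (λ e → ∑-comm (λ v i → when ⌊ end G e i ≟ v ⌋ (φ e i))) ⟩
      sum (λ e → sum λ i → sum λ v → when ⌊ end G e i ≟ v ⌋ (φ e i))
        ≈⟨ sum-cong (λ e → sum-cong λ i → sum-point (end G e i) (φ e i)) ⟩
      sum (λ e → sum λ i → φ e i)
        ≈⟨ sum-cong (λ e → ∙-congˡ {φ e zero} (identityʳ (φ e (suc zero)))) ⟩
      sum (λ e → φ e zero ∙ φ e (suc zero)) ∎

module ℕΣ = Sums ℕ.+-0-commutativeMonoid

module ℤΣ = Sums ℤ.+-0-commutativeMonoid

Σℕ≡sum : ∀ {k} (f : Fin k → ℕ) → Σℕ f ≡ ℕΣ.sum f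
Σℕ≡sum {zero}  f = refl
Σℕ≡sum {suc k} f = cong (f zero ℕ.+_) (Σℕ≡sum (f ∘ suc))

Σℤ≡sum : ∀ {k} (f : Fin k → ℤ) → Σℤ f ≡ ℤΣ.sum f
Σℤ≡sum {zero}  f = refl
Σℤ≡sum {suc k} f = cong (λ s → f zero ℤ.+ s) (Σℤ≡sum (f ∘ suc))

-- The three half-edges at a vertex of a cubic graph

module _ (G : Graph) where

  HalfEdge : Set
  HalfEdge = Fin (nE G) × Fin 2

  endOf : HalfEdge → Fin (nV G)
  endOf (e , i) = end G e i

  halfEdgesAt : Fin (nV G) → List HalfEdge
  halfEdgesAt v = filter (λ h → endOf h ≟ v) (cartesianProduct (allFin _) (allFin _))

  at-list : ∀ M v φ → let open CommutativeMonoid M using (_≈_; _∙_) in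
    Sums.at M G v φ ≈ Sums.listSum M (λ h → φ (proj₁ h) (proj₂ h)) (halfEdgesAt v)
  at-list M v φ = ≈-sym (begin
    listSum (λ h → φ (proj₁ h) (proj₂ h)) (halfEdgesAt v)
      ≈⟨ listSum-filter (λ h → endOf h ≟ v) _ (cartesianProduct (allFin (nE G)) (allFin 2)) ⟩
    listSum f (cartesianProduct (allFin _) (allFin _))
      ≈⟨ listSum-product f (allFin _) (allFin _) ⟩
    listSum (λ e → listSum (λ i → f (e , i)) (allFin 2)) (allFin _)
      ≈⟨ listSum-cong (λ e → sum-allFin (λ i → f (e , i)) id) (allFin (nE G)) ⟩
    listSum (λ e → sum (λ i → f (e , i))) (allFin _)
      ≈⟨ sum-allFin (λ e → sum (λ i → f (e , i))) id ⟩
    at G v φ ∎)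
    where
    open CommutativeMonoid M using (Carrier; setoid) renaming (sym to ≈-sym)
    open Sums M
    open import Relation.Binary.Reasoning.Setoid setoid
    f : HalfEdge → Carrier
    f h = when ⌊ endOf h ≟ v ⌋ (φ (proj₁ h) (proj₂ h))

  -- A permutation instead of an equality of lists, so that the three half-edges can be ordered by
  -- their roles: even value first, or by colour.
  Star : Fin (nV G) → HalfEdge → HalfEdge → HalfEdge → Set
  Star v a b c = halfEdgesAt v ↭ a ∷ b ∷ c ∷ []

  ∈-halfEdgesAt : ∀ h → h ∈ halfEdgesAt (endOf h)
  ∈-halfEdgesAt h = ∈-filter⁺ (λ h′ → endOf h′ ≟ endOf h)
    (∈-cartesianProduct⁺ (∈-allFin (proj₁ h)) (∈-allFin (proj₂ h))) refl

  abstract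
    cubicStar : Cubic G → ∀ v → ∃[ a ] ∃[ b ] ∃[ c ] Star v a b c
    cubicStar cubic v = triple (halfEdgesAt v) length≡3
      where
      open ℕΣ
      count : ∀ (xs : List HalfEdge) → listSum (λ _ → 1) xs ≡ length xs
      count []       = refl
      count (x ∷ xs) = cong suc (count xs)
      length≡3 : length (halfEdgesAt v) ≡ 3
      length≡3 = begin
        length (halfEdgesAt v)            ≡⟨ count (halfEdgesAt v) ⟨
        listSum (λ _ → 1) (halfEdgesAt v) ≡⟨ at-list ℕ.+-0-commutativeMonoid v (λ _ _ → 1) ⟨
        at G v (λ _ _ → 1)                ≡⟨ sum-cong (λ e → Σℕ≡sum (λ i → when ⌊ end G e i ≟ v ⌋ 1)) ⟨
        sum (λ e → Σℕ (λ i → when ⌊ end G e i ≟ v ⌋ 1))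
          ≡⟨ Σℕ≡sum (λ e → Σℕ (λ i → when ⌊ end G e i ≟ v ⌋ 1)) ⟨
        degree G v                        ≡⟨ cubic v ⟩
        3 ∎
        where open ≡.≡-Reasoning
      triple : ∀ (hs : List HalfEdge) → length hs ≡ 3 → ∃[ a ] ∃[ b ] ∃[ c ] hs ↭ a ∷ b ∷ c ∷ []
      triple (a ∷ b ∷ c ∷ []) refl = a , b , c , ↭-refl

  module _ {v a b c} (s : Star v a b c) where

    star-sum : ∀ M φ → let open CommutativeMonoid M using (_≈_; _∙_) in
      Sums.at M G v φ ≈
        φ (proj₁ a) (proj₂ a) ∙ (φ (proj₁ b) (proj₂ b) ∙ φ (proj₁ c) (proj₂ c))
    star-sum M φ = ≈-trans (at-list M v φ)
      (≈-trans (Sums.listSum-↭ M (λ h → φ (proj₁ h) (proj₂ h)) s) (∙-congˡ (∙-congˡ (identityʳ _))))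
      where open CommutativeMonoid M using (∙-congˡ; identityʳ) renaming (trans to ≈-trans)

    star-cover : ∀ h → endOf h ≡ v → h ≡ a ⊎ h ≡ b ⊎ h ≡ c
    star-cover h refl with ∈-resp-↭ s (∈-halfEdgesAt h)
    ... | here p                 = inj₁ p
    ... | there (here p)         = inj₂ (inj₁ p)
    ... | there (there (here p)) = inj₂ (inj₂ p)

    star-end : ∀ {h} → h ∈ a ∷ b ∷ c ∷ [] → endOf h ≡ v
    star-end h∈ = proj₂ (∈-filter⁻ (λ h → endOf h ≟ v)
      {xs = cartesianProduct (allFin _) (allFin _)} (∈-resp-↭ (↭-sym s) h∈))

    star-distinct : a ≢ b × a ≢ c × b ≢ c
    star-distinct with ↭ₛ.Unique-resp-↭ (≡.setoid HalfEdge) (↭⇒↭ₛ s)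
      (Unique.filter⁺ (λ h → endOf h ≟ v) (Unique.cartesianProduct⁺ (Unique.allFin⁺ _) (Unique.allFin⁺ _)))
    ... | (a≢b ∷ a≢c ∷ []) ∷ (b≢c ∷ []) ∷ [] ∷ [] = a≢b , a≢c , b≢c

    star-swap₁₂ : Star v b a c
    star-swap₁₂ = ↭-trans s (↭-swap a b ↭-refl)

    star-swap₂₃ : Star v a c b
    star-swap₂₃ = ↭-trans s (↭-prep a (↭-swap b c ↭-refl))

-- Walks and potentials

-- `Bool` plays the role of 𝔽₂: an edge set is its characteristic vector and `xor` is symmetric
-- difference.
xorMonoid : CommutativeMonoid 0ℓ 0ℓ
xorMonoid = CommutativeRing.+-commutativeMonoid xor-∧-commutativeRing

module ⊕ = Sums xorMonoid

xor-cancel : ∀ x y → x xor (x xor y) ≡ y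
xor-cancel x y = trans (sym (xor-assoc x x y)) (cong (_xor y) (xor-same x))

sum-delta : ∀ {n} (j : Fin n) (f : Fin n → Bool) → ⊕.sum (λ i → ⌊ j ≟ i ⌋ ∧ f i) ≡ f j
sum-delta {n} j f = trans (⊕.sum-cong {n} (λ i → restate i (j ≟ i))) (⊕.sum-point j (f j))
  where
  restate : ∀ i (d : Dec (j ≡ i)) → ⌊ d ⌋ ∧ f i ≡ ⊕.when ⌊ d ⌋ (f j)
  restate i (yes refl) = refl
  restate i (no _)     = refl

when-false : ∀ b → ⊕.when b false ≡ false
when-false true  = refl
when-false false = refl

when-true : ∀ b → ⊕.when b true ≡ b
when-true true  = refl
when-true false = refl

sum-false : ∀ {n} {f : Fin n → Bool} → (∀ i → f i ≡ false) → ⊕.sum f ≡ false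
sum-false {n} = ⊕.sum-ε {n}

module Walks (G : Graph) (A : Fin (nE G) → Bool) where

  V E : Set
  V = Fin (nV G)
  E = Fin (nE G)

  -- A step leaves along the half-edge `(e , i)` and arrives at the other half-edge of `e`, so loops
  -- and parallel edges are traversed unambiguously.
  data Walk : V → V → Set where
    []   : ∀ {u} → Walk u u
    step : ∀ {u v} e i → end G e i ≡ u → A e ≡ true →
           Walk (end G e (opposite i)) v → Walk u v

  _++ʷ_ : ∀ {u v w} → Walk u v → Walk v w → Walk u w
  []             ++ʷ q = q
  step e i p a w ++ʷ q = step e i p a (w ++ʷ q)

  -- The edges used an odd number of times. For a closed walk this is the even edge set that the
  -- walk represents.
  edgeParity : ∀ {u v} → Walk u v → E → Bool
  edgeParity []               e′ = false
  edgeParity (step e i _ _ w) e′ = ⌊ e ≟ e′ ⌋ xor edgeParity w e′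

  edgeParity⊆ : ∀ {u v} (w : Walk u v) e → edgeParity w e ≡ true → A e ≡ true
  edgeParity⊆ (step e i _ a w) e′ odd with e ≟ e′
  ... | yes refl = a
  ... | no _     = edgeParity⊆ w e′ odd

  -- Each step contributes its two ends, and the sum telescopes to the ends of the walk.
  edgeParity-at : ∀ {u v} (w : Walk u v) x →
    ⊕.at G x (λ e _ → edgeParity w e) ≡ ⌊ u ≟ x ⌋ xor ⌊ v ≟ x ⌋
  edgeParity-at {u} [] x = trans
    (sum-false {nE G} λ e → sum-false {2} λ i → when-false ⌊ end G e i ≟ x ⌋)
    (sym (xor-same ⌊ u ≟ x ⌋))
  edgeParity-at {u} {v} (step e i refl _ w) x = begin
    ⊕.at G x (λ e′ _ → ⌊ e ≟ e′ ⌋ xor edgeParity w e′)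
      ≡⟨ ⊕.at-∙ G x (λ e′ _ → ⌊ e ≟ e′ ⌋) (λ e′ _ → edgeParity w e′) ⟩
    ⊕.at G x (λ e′ _ → ⌊ e ≟ e′ ⌋) xor ⊕.at G x (λ e′ _ → edgeParity w e′)
      ≡⟨ cong₂ _xor_ single (edgeParity-at w x) ⟩
    (⌊ end G e zero ≟ x ⌋ xor ⌊ end G e (suc zero) ≟ x ⌋) xor (⌊ end G e (opposite i) ≟ x ⌋ xor ⌊ v ≟ x ⌋)
      ≡⟨ telescope i ⟩
    ⌊ end G e i ≟ x ⌋ xor ⌊ v ≟ x ⌋ ∎
    where
    open ≡-Reasoning
    open xor-∧-Solver
    incidence : E → Bool
    incidence e′ = ⊕.sum λ i → ⌊ end G e′ i ≟ x ⌋
    when-swap : ∀ e′ → ⊕.sum (λ i → ⊕.when ⌊ end G e′ i ≟ x ⌋ ⌊ e ≟ e′ ⌋) ≡ ⌊ e ≟ e′ ⌋ ∧ incidence e′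
    when-swap e′ with e ≟ e′
    ... | yes _ = ⊕.sum-cong {2} λ i → when-true ⌊ end G e′ i ≟ x ⌋
    ... | no _  = sum-false {2} λ i → when-false ⌊ end G e′ i ≟ x ⌋
    single : ⊕.at G x (λ e′ _ → ⌊ e ≟ e′ ⌋) ≡ ⌊ end G e zero ≟ x ⌋ xor ⌊ end G e (suc zero) ≟ x ⌋
    single = trans (⊕.sum-cong {nE G} when-swap)
      (trans (sum-delta e incidence)
        (cong (⌊ end G e zero ≟ x ⌋ xor_) (xor-identityʳ ⌊ end G e (suc zero) ≟ x ⌋)))
    telescope : ∀ i →
      (⌊ end G e zero ≟ x ⌋ xor ⌊ end G e (suc zero) ≟ x ⌋) xor (⌊ end G e (opposite i) ≟ x ⌋ xor ⌊ v ≟ x ⌋)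
        ≡ ⌊ end G e i ≟ x ⌋ xor ⌊ v ≟ x ⌋
    telescope zero = solve 3 (λ a b c → (a :+ b) :+ (b :+ c) := a :+ c) refl
      ⌊ end G e zero ≟ x ⌋ ⌊ end G e (suc zero) ≟ x ⌋ ⌊ v ≟ x ⌋
    telescope (suc zero) = solve 3 (λ a b c → (a :+ b) :+ (a :+ c) := b :+ c) refl
      ⌊ end G e zero ≟ x ⌋ ⌊ end G e (suc zero) ≟ x ⌋ ⌊ v ≟ x ⌋

  module _ (t : E → Bool) where

    weight : ∀ {u v} → Walk u v → Bool
    weight []               = false
    weight (step e i _ _ w) = t e xor weight w

    weight-++ : ∀ {u v w} (p : Walk u v) (q : Walk v w) → weight (p ++ʷ q) ≡ weight p xor weight q
    weight-++ []               q = refl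
    weight-++ (step e i _ _ p) q = trans (cong (t e xor_) (weight-++ p q)) (sym (xor-assoc (t e) _ _))

    edgeParity-weight : ∀ {u v} (w : Walk u v) → ⊕.sum (λ e → edgeParity w e ∧ t e) ≡ weight w
    edgeParity-weight [] = sum-false {nE G} λ _ → refl
    edgeParity-weight (step e i _ _ w) = begin
      ⊕.sum (λ e′ → (⌊ e ≟ e′ ⌋ xor edgeParity w e′) ∧ t e′)
        ≡⟨ ⊕.sum-cong {nE G} (λ e′ → ∧-distribʳ-xor (t e′) ⌊ e ≟ e′ ⌋ (edgeParity w e′)) ⟩
      ⊕.sum (λ e′ → (⌊ e ≟ e′ ⌋ ∧ t e′) xor (edgeParity w e′ ∧ t e′))
        ≡⟨ ⊕.∑-distrib-+ (λ e′ → ⌊ e ≟ e′ ⌋ ∧ t e′) _ ⟩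
      ⊕.sum (λ e′ → ⌊ e ≟ e′ ⌋ ∧ t e′) xor ⊕.sum (λ e′ → edgeParity w e′ ∧ t e′)
        ≡⟨ cong₂ _xor_ (sum-delta e t) (edgeParity-weight w) ⟩
      t e xor weight w ∎
      where open ≡-Reasoning

    -- The state after the edges `es` have been processed: `label` names the classes merged so far,
    -- and by `connect` the differences of `value` within a class are realised by walks. The
    -- equation of an edge that closes a cycle may still fail.
    record Potential (es : List E) : Set where
      field
        label   : V → V
        value   : V → Bool
        connect : ∀ x y → label x ≡ label y → Σ[ w ∈ Walk x y ] weight w ≡ value x xor value y
        joined  : ∀ {e} → e ∈ es → A e ≡ true → label (end G e zero) ≡ label (end G e (suc zero))

    -- Processing an edge merges the classes of its ends and shifts the values on one of them.
    potential : ∀ es → Potential es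
    potential [] = record
      { label   = id
      ; value   = const false
      ; connect = λ { x .x refl → [] , refl }
      ; joined  = λ ()
      }
    potential (e ∷ es) with A e Bool.≟ true
    ... | no ¬a = record
      { label   = label
      ; value   = value
      ; connect = connect
      ; joined  = λ { (here refl) a → contradiction a ¬a ; (there e∈) a → joined e∈ a }
      }
      where open Potential (potential es)
    ... | yes a = record
      { label   = λ x → merge x (label x ≟ label u)
      ; value   = λ x → shift x (label x ≟ label u)
      ; connect = λ x y → link x y (label x ≟ label u) (label y ≟ label u)
      ; joined  = λ
          { (here refl) _ → merged (label u ≟ label u) (label v ≟ label u)
          ; (there e∈) b → respects _ _ (joined e∈ b) (_ ≟ _) (_ ≟ _) }
      }
      where
      open Potential (potential es)
      u v : V
      u = end G e zero
      v = end G e (suc zero)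
      merge : ∀ x → Dec (label x ≡ label u) → V
      merge x (yes _) = label v
      merge x (no _)  = label x
      shift : ∀ x → Dec (label x ≡ label u) → Bool
      -- The shift gives `u` the value `value v xor t e`, which solves the equation of `e` when two
      -- classes are merged. If `v` lies in the same class it is shifted as well, and all
      -- differences stay.
      shift x (yes _) = value x xor ((value u xor value v) xor t e)
      shift x (no _)  = value x
      respects : ∀ x y → label x ≡ label y → ∀ dx dy → merge x dx ≡ merge y dy
      respects x y eq (yes _) (yes _) = refl
      respects x y eq (yes p) (no ¬p) = contradiction (trans (sym eq) p) ¬p
      respects x y eq (no ¬p) (yes p) = contradiction (trans eq p) ¬p
      respects x y eq (no _)  (no _)  = eq
      merged : ∀ du dv → merge u du ≡ merge v dv
      merged (yes _) (yes _) = refl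
      merged (yes _) (no _)  = refl
      merged (no ¬p) _       = contradiction refl ¬p
      open xor-∧-Solver
      link : ∀ x y dx dy → merge x dx ≡ merge y dy →
             Σ[ w ∈ Walk x y ] weight w ≡ shift x dx xor shift y dy
      link x y (no _) (no _) eq = connect x y eq
      link x y (yes p) (yes q) eq with connect x y (trans p (sym q))
      ... | w , eq′ = w , trans eq′
        (solve 3 (λ a b c → a :+ b := (a :+ c) :+ (b :+ c)) refl (value x) (value y) _)
      link x y (yes p) (no _) eq with connect x u p | connect v y eq
      ... | w₁ , eq₁ | w₂ , eq₂ = w₁ ++ʷ step e zero refl a w₂ ,
        trans (weight-++ w₁ _) (trans (cong₂ (λ b c → b xor (t e xor c)) eq₁ eq₂)
          (solve 5 (λ x u v y s → (x :+ u) :+ (s :+ (v :+ y)) := (x :+ ((u :+ v) :+ s)) :+ y) refl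
            (value x) (value u) (value v) (value y) (t e)))
      link x y (no _) (yes q) eq with connect x v eq | connect u y (sym q)
      ... | w₁ , eq₁ | w₂ , eq₂ = w₁ ++ʷ step e (suc zero) refl a w₂ ,
        trans (weight-++ w₁ _) (trans (cong₂ (λ b c → b xor (t e xor c)) eq₁ eq₂)
          (solve 5 (λ x u v y s → (x :+ v) :+ (s :+ (u :+ y)) := x :+ (y :+ ((u :+ v) :+ s))) refl
            (value x) (value u) (value v) (value y) (t e)))

    -- An edge of `A` whose equation fails for `value`, followed by a walk realising the difference
    -- of the values at its ends, is a closed walk of odd weight.
    balancedOrOddClosedWalk :
      (Σ[ p ∈ (Fin (nV G) → Bool) ] ∀ e → A e ≡ true → p (end G e zero) xor p (end G e (suc zero)) ≡ t e)
      ⊎ (∃[ u ] Σ[ w ∈ Walk u u ] weight w ≡ true)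
    balancedOrOddClosedWalk
      with any? (λ e → (A e Bool.≟ true) ×-dec
                      ¬? (value (end G e zero) xor value (end G e (suc zero)) Bool.≟ t e))
      where open Potential (potential (allFin _))
    ... | no balanced = inj₁ (value , λ e a → decidable-stable (_ Bool.≟ _) λ ≢t → balanced (e , a , ≢t))
      where open Potential (potential (allFin _))
    ... | yes (e , a , ≢t) with connect (end G e (suc zero)) (end G e zero) (sym (joined (∈-allFin e) a))
      where open Potential (potential (allFin _))
    ...   | w , eq = inj₂ (end G e zero , step e zero refl a w ,
        trans (cong (t e xor_) (trans eq (xor-comm (value (end G e (suc zero))) _))) (xor-≢ ≢t))
      where
      open Potential (potential (allFin _))
      xor-≢ : ∀ {x y} → x ≢ y → y xor x ≡ true
      xor-≢ {true}  {true}  x≢y = contradiction refl x≢y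
      xor-≢ {true}  {false} x≢y = refl
      xor-≢ {false} {true}  x≢y = refl
      xor-≢ {false} {false} x≢y = contradiction refl x≢y

-- Duality between potentials and even edge sets

module _ (G : Graph) where

  EvenDegrees : (Fin (nE G) → Bool) → Set
  EvenDegrees X = ∀ v → ⊕.at G v (λ e _ → X e) ≡ false

  abstract
    -- The Fredholm alternative over 𝔽₂. The obstruction consists of the edges that an odd closed
    -- walk uses oddly often.
    balancedOrOddEvenSubset : ∀ (A t : Fin (nE G) → Bool) →
      (Σ[ p ∈ (Fin (nV G) → Bool) ] ∀ e → A e ≡ true → p (end G e zero) xor p (end G e (suc zero)) ≡ t e)
      ⊎ (Σ[ Y ∈ (Fin (nE G) → Bool) ] EvenDegrees Y × (∀ e → Y e ≡ true → A e ≡ true) ×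
           ⊕.sum (λ e → Y e ∧ t e) ≡ true)
    balancedOrOddEvenSubset A t with balancedOrOddClosedWalk t
      where open Walks G A
    ... | inj₁ balanced      = inj₁ balanced
    ... | inj₂ (u , w , odd) = inj₂ (edgeParity w , (λ v → trans (edgeParity-at w v) (xor-same ⌊ u ≟ v ⌋)) ,
        edgeParity⊆ w , trans (edgeParity-weight t w) odd)
      where open Walks G A

  at-∧ : ∀ v (p : Fin (nV G) → Bool) φ → ⊕.at G v (λ e i → p (end G e i) ∧ φ e i) ≡ p v ∧ ⊕.at G v φ
  at-∧ v p φ = trans
    (⊕.at-cong G v {λ e i → p (end G e i) ∧ φ e i} {λ e i → p v ∧ φ e i} λ { e i refl → refl })
    (scale (p v))
    where
    scale : ∀ b → ⊕.at G v (λ e i → b ∧ φ e i) ≡ b ∧ ⊕.at G v φ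
    scale true  = refl
    scale false = sum-false {nE G} λ e → sum-false {2} λ i → when-false ⌊ end G e i ≟ v ⌋

  -- Cuts are orthogonal to even edge sets: with `p` inserted, the sum regroups by vertices, and
  -- `p v` is multiplied by the even degree of `v` in `X`.
  evenDegrees-balanced : ∀ {X} {t : Fin (nE G) → Bool} → EvenDegrees X → ∀ (p : Fin (nV G) → Bool) →
    (∀ e → X e ≡ true → p (end G e zero) xor p (end G e (suc zero)) ≡ t e) →
    ⊕.sum (λ e → X e ∧ t e) ≡ false
  evenDegrees-balanced {X} {t} even p balanced = begin
    ⊕.sum (λ e → X e ∧ t e)
      ≡⟨ ⊕.sum-cong {nE G} split ⟩
    ⊕.sum (λ e → (p (end G e zero) ∧ X e) xor (p (end G e (suc zero)) ∧ X e))
      ≡⟨ ⊕.handshake G (λ e i → p (end G e i) ∧ X e) ⟨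
    ⊕.sum (λ v → ⊕.at G v (λ e i → p (end G e i) ∧ X e))
      ≡⟨ sum-false {nV G} (λ v → trans (at-∧ v p (λ e _ → X e))
           (trans (cong (p v ∧_) (even v)) (∧-zeroʳ (p v)))) ⟩
    false ∎
    where
    open ≡-Reasoning
    split : ∀ e → X e ∧ t e ≡ (p (end G e zero) ∧ X e) xor (p (end G e (suc zero)) ∧ X e)
    split e with X e in eq
    ... | true  = trans (sym (balanced e eq))
      (sym (cong₂ _xor_ (∧-identityʳ (p (end G e zero))) (∧-identityʳ (p (end G e (suc zero))))))
    ... | false = sym (cong₂ _xor_ (∧-zeroʳ (p (end G e zero))) (∧-zeroʳ (p (end G e (suc zero)))))

-- Simple walks and circuits

isNegative : Sign → Bool
isNegative pos = false
isNegative neg = true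

bit : Bool → ℕ
bit b = if b then 1 else 0

Σℕ-parity : ∀ {k} (f : Fin k → ℕ) (b : Fin k → Bool) → (∀ i → f i ≡ bit (b i)) →
  Σℕ f % 2 ≡ bit (⊕.sum b)
Σℕ-parity {zero}  f b f≡b = refl
Σℕ-parity {suc k} f b f≡b = begin
  (f zero ℕ.+ Σℕ (f ∘ suc)) % 2                ≡⟨ %-distribˡ-+ (f zero) (Σℕ (f ∘ suc)) 2 ⟩
  (f zero % 2 ℕ.+ Σℕ (f ∘ suc) % 2) % 2
    ≡⟨ cong₂ (λ m n → (m % 2 ℕ.+ n) % 2) (f≡b zero) (Σℕ-parity (f ∘ suc) (b ∘ suc) (f≡b ∘ suc)) ⟩
  (bit (b zero) % 2 ℕ.+ bit (⊕.sum (b ∘ suc))) % 2 ≡⟨ add (b zero) (⊕.sum (b ∘ suc)) ⟩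
  bit (b zero xor ⊕.sum (b ∘ suc))             ∎
  where
  open ≡-Reasoning
  add : ∀ x y → (bit x % 2 ℕ.+ bit y) % 2 ≡ bit (x xor y)
  add true  true  = refl
  add true  false = refl
  add false true  = refl
  add false false = refl

-- The summand of negCount is a function local to Defs; unification recovers it.
summand : ∀ {k} {f : Fin k → ℕ} (n : ℕ) → n ≡ Σℕ f → Fin k → ℕ
summand {f = f} _ _ = f

negCount-parity : ∀ {G} (σ : Signature G) (C : Circuit G) →
  negCount σ C % 2 ≡ bit (⊕.sum (λ i → isNegative (σ (edge C i))))
negCount-parity σ C = Σℕ-parity (summand (negCount σ C) refl) _ summand≡bit
  where
  summand≡bit : ∀ i → summand (negCount σ C) refl i ≡ bit (isNegative (σ (edge C i)))
  summand≡bit i with σ (edge C i)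
  ... | pos = refl
  ... | neg = refl

module SimpleWalks (G : Graph) (A : Fin (nE G) → Bool) where
  open Walks G A

  On : ∀ {u v} → V → Walk u v → Set
  On x ([] {u})             = x ≡ u
  On x (step {u} _ _ _ _ w) = x ≡ u ⊎ On x w

  On? : ∀ {u v} x (w : Walk u v) → Dec (On x w)
  On? x ([] {u})             = x ≟ u
  On? x (step {u} _ _ _ _ w) = (x ≟ u) ⊎-dec On? x w

  first-on : ∀ {u v} (w : Walk u v) → On u w
  first-on []               = refl
  first-on (step _ _ _ _ _) = inj₁ refl

  last-on : ∀ {u v} (w : Walk u v) → On v w
  last-on []               = refl
  last-on (step _ _ _ _ w) = inj₂ (last-on w)

  Simple : ∀ {u v} → Walk u v → Set
  Simple []                   = ⊤
  Simple (step {u} _ _ _ _ w) = ¬ On u w × Simple w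

  steps : ∀ {u v} → Walk u v → ℕ
  steps []               = 0
  steps (step _ _ _ _ w) = suc (steps w)

  vertex : ∀ {u v} (w : Walk u v) → Fin (suc (steps w)) → V
  vertex ([] {u})             _       = u
  vertex (step {u} _ _ _ _ w) zero    = u
  vertex (step _ _ _ _ w)     (suc j) = vertex w j

  edgeOf : ∀ {u v} (w : Walk u v) → Fin (steps w) → E
  edgeOf (step e _ _ _ w) zero    = e
  edgeOf (step _ _ _ _ w) (suc j) = edgeOf w j

  vertex-zero : ∀ {u v} (w : Walk u v) → vertex w zero ≡ u
  vertex-zero []               = refl
  vertex-zero (step _ _ _ _ _) = refl

  vertex-last : ∀ {u v} (w : Walk u v) → vertex w (fromℕ (steps w)) ≡ v
  vertex-last []               = refl
  vertex-last (step _ _ _ _ w) = vertex-last w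

  vertex-on : ∀ {u v} (w : Walk u v) j → On (vertex w j) w
  vertex-on []               j       = refl
  vertex-on (step _ _ _ _ w) zero    = inj₁ refl
  vertex-on (step _ _ _ _ w) (suc j) = inj₂ (vertex-on w j)

  edgeOf-in : ∀ {u v} (w : Walk u v) j → A (edgeOf w j) ≡ true
  edgeOf-in (step _ _ _ a w) zero    = a
  edgeOf-in (step _ _ _ _ w) (suc j) = edgeOf-in w j

  edgeOf-ends : ∀ {u v} (w : Walk u v) j i → On (end G (edgeOf w j) i) w
  edgeOf-ends (step e zero refl _ w)       zero zero       = inj₁ refl
  edgeOf-ends (step e zero refl _ w)       zero (suc zero) = inj₂ (first-on w)
  edgeOf-ends (step e (suc zero) refl _ w) zero zero       = inj₂ (first-on w)
  edgeOf-ends (step e (suc zero) refl _ w) zero (suc zero) = inj₁ refl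
  edgeOf-ends (step _ _ _ _ w) (suc j) i = inj₂ (edgeOf-ends w j i)

  vertex-joins : ∀ {u v} (w : Walk u v) j →
    Joins G (edgeOf w j) (vertex w (inject₁ j)) (vertex w (suc j))
  vertex-joins (step e zero p _ w)       zero = inj₁ (p , sym (vertex-zero w))
  vertex-joins (step e (suc zero) p _ w) zero = inj₂ (sym (vertex-zero w) , p)
  vertex-joins (step _ _ _ _ w) (suc j) = vertex-joins w j

  vertex-injective : ∀ {u v} (w : Walk u v) → Simple w → Injective _≡_ _≡_ (vertex w)
  vertex-injective []               _ {zero} {zero} _ = refl
  vertex-injective (step _ _ _ _ w) _        {zero}  {zero}  _  = refl
  vertex-injective (step _ _ _ _ w) (u∉ , _) {zero}  {suc k} eq =
    contradiction (subst (λ x → On x w) (sym eq) (vertex-on w k)) u∉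
  vertex-injective (step _ _ _ _ w) (u∉ , _) {suc j} {zero}  eq =
    contradiction (subst (λ x → On x w) eq (vertex-on w j)) u∉
  vertex-injective (step _ _ _ _ w) (_ , s)  {suc j} {suc k} eq = cong suc (vertex-injective w s eq)

  edgeOf-injective : ∀ {u v} (w : Walk u v) → Simple w → Injective _≡_ _≡_ (edgeOf w)
  edgeOf-injective (step _ _ _ _ w) _ {zero} {zero} _ = refl
  edgeOf-injective (step e i refl _ w) (u∉ , _) {zero} {suc k} eq =
    contradiction (subst (λ f → On (end G f i) w) (sym eq) (edgeOf-ends w k i)) u∉
  edgeOf-injective (step e i refl _ w) (u∉ , _) {suc j} {zero} eq =
    contradiction (subst (λ f → On (end G f i) w) eq (edgeOf-ends w j i)) u∉
  edgeOf-injective (step _ _ _ _ w) (_ , s) {suc j} {suc k} eq = cong suc (edgeOf-injective w s eq)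

  simplePath : ∀ {u v} (w : Walk u v) → Simple w → Path G
  simplePath w s = record
    { plen  = steps w
    ; pvert = vertex w
    ; pedge = edgeOf w
    ; pvinj = vertex-injective w s
    ; peinj = edgeOf-injective w s
    ; pjoin = vertex-joins w
    }

  module _ (t : E → Bool) where

    weight-edges : ∀ {u v} (w : Walk u v) → ⊕.sum (t ∘ edgeOf w) ≡ weight t w
    weight-edges []               = refl
    weight-edges (step e _ _ _ w) = cong (t e xor_) (weight-edges w)

    -- Only the empty walk is both closed and simple.
    closed-simple-weight : ∀ {u v} (w : Walk u v) → u ≡ v → Simple w → weight t w ≡ false
    closed-simple-weight []               _    _        = refl
    closed-simple-weight (step _ _ _ _ w) refl (u∉ , _) = contradiction (last-on w) u∉

    -- A circuit cut open after its first edge, because a closed walk with edges is never `Simple`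
    -- but the way back is. For a loop, `back` is empty.
    record OddCycle : Set where
      field
        e      : E
        i      : Fin 2
        inA    : A e ≡ true
        back   : Walk (end G e (opposite i)) (end G e i)
        simple : Simple back
        odd    : t e xor weight t back ≡ true

      cycle : Walk (end G e i) (end G e i)
      cycle = step e i refl inA back

      -- A simple way back along e itself would be just e, making the total weight even.
      e-fresh : ∀ j → edgeOf back j ≢ e
      e-fresh = fresh back refl refl simple odd
        where
        fresh : ∀ {x y} (w : Walk x y) → x ≡ end G e (opposite i) → y ≡ end G e i → Simple w →
          t e xor weight t w ≡ true → ∀ j → edgeOf w j ≢ e
        fresh (step _ i′ p _ w) x≡ y≡ (x∉ , s) odd zero refl = directions i i′ refl refl
          where
          sameDirection : end G e i′ ≢ end G e i
          sameDirection eq = x∉ (subst (λ z → On z w) (trans y≡ (trans (sym eq) p)) (last-on w))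
          reversed : end G e (opposite i′) ≢ end G e i
          reversed eq with () ← trans (sym odd) (trans
            (xor-cancel (t e) (weight t w)) (closed-simple-weight w (trans eq (sym y≡)) s))
          directions : ∀ k l → i ≡ k → i′ ≡ l → ⊥
          directions zero       zero       p q = sameDirection (cong (end G e) (trans q (sym p)))
          directions zero       (suc zero) p q = reversed (cong (end G e) (trans (cong opposite q) (sym p)))
          directions (suc zero) zero       p q = reversed (cong (end G e) (trans (cong opposite q) (sym p)))
          directions (suc zero) (suc zero) p q = sameDirection (cong (end G e) (trans q (sym p)))
        -- After its first step, a walk using `e` would revisit its own starting vertex, which is an
        -- end of `e`.
        fresh (step _ _ _ _ w) refl _ (x∉ , _) _ (suc j) eq =
          x∉ (subst (λ f → On (end G f (opposite i)) w) eq (edgeOf-ends w j (opposite i)))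

      circuit : Circuit G
      circuit = record
        { len    = suc (steps back)
        ; len≥1  = ℕ.s≤s ℕ.z≤n
        ; vert   = vertex cycle
        ; edge   = edgeOf cycle
        ; closed = sym (vertex-last cycle)
        ; vinj   = vertices
        ; einj   = edges
        ; joins  = vertex-joins cycle
        }
        where
        -- The starting vertex of the circuit is the last vertex of the simple walk `back`, hence
        -- none of the earlier ones.
        end≢inner : ∀ j → end G e i ≢ vertex back (inject₁ j)
        end≢inner j eq = fromℕ≢inject₁ (vertex-injective back simple (trans (vertex-last back) eq))
        vertices : Injective _≡_ _≡_ (vertex cycle ∘ inject₁)
        vertices {zero}  {zero}  _  = refl
        vertices {zero}  {suc k} eq = contradiction eq (end≢inner k)
        vertices {suc j} {zero}  eq = contradiction (sym eq) (end≢inner j)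
        vertices {suc j} {suc k} eq = cong suc (inject₁-injective (vertex-injective back simple eq))
        edges : Injective _≡_ _≡_ (edgeOf cycle)
        edges {zero}  {zero}  _  = refl
        edges {zero}  {suc k} eq = contradiction (sym eq) (e-fresh k)
        edges {suc j} {zero}  eq = contradiction eq (e-fresh j)
        edges {suc j} {suc k} eq = cong suc (edgeOf-injective back simple eq)

      circuit-in : ∀ j → A (edge circuit j) ≡ true
      circuit-in = edgeOf-in cycle

      circuit-weight : ⊕.sum (t ∘ edge circuit) ≡ true
      circuit-weight = trans (weight-edges cycle) odd

    record Split {u v} (x : V) (w : Walk u v) : Set where
      field
        before        : Walk u x
        after         : Walk x v
        before-simple : Simple before
        after-simple  : Simple after
        before-on     : ∀ y → On y before → On y w
        after-on      : ∀ y → On y after → On y w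
        weights       : weight t w ≡ weight t before xor weight t after

    split : ∀ {u v} x (w : Walk u v) → On x w → Simple w → Split x w
    split x [] refl _ = record
      { before = [] ; after = [] ; before-simple = tt ; after-simple = tt
      ; before-on = λ _ p → p ; after-on = λ _ p → p ; weights = refl }
    split x w@(step _ _ _ _ _) (inj₁ refl) s = record
      { before = [] ; after = w ; before-simple = tt ; after-simple = s
      ; before-on = λ { _ refl → inj₁ refl } ; after-on = λ _ p → p ; weights = refl }
    split x (step e i p a w) (inj₂ x∈) (u∉ , s) = record
      { before        = step e i p a before
      ; after         = after
      ; before-simple = (λ u∈ → u∉ (before-on _ u∈)) , before-simple
      ; after-simple  = after-simple
      ; before-on     = λ { _ (inj₁ eq) → inj₁ eq ; y (inj₂ y∈) → inj₂ (before-on y y∈) }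
      ; after-on      = λ y y∈ → inj₂ (after-on y y∈)
      ; weights       = trans (cong (t e xor_) weights) (sym (xor-assoc (t e) _ _))
      }
      where open Split (split x w x∈ s)

    record LoopErasure {u v} (w : Walk u v) : Set where
      field
        erased : Walk u v
        simple : Simple erased
        on     : ∀ x → On x erased → On x w
        same   : weight t erased ≡ weight t w

    -- Steps are prepended to an already simple walk. If the new start lies on it, a closed piece
    -- appears: either this piece has odd weight and is the cycle sought, or it is dropped without
    -- changing the weight.
    eraseLoops : ∀ {u v} (w : Walk u v) → LoopErasure w ⊎ OddCycle
    eraseLoops [] = inj₁ (record { erased = [] ; simple = tt ; on = λ _ p → p ; same = refl })
    eraseLoops (step e i refl a w) with eraseLoops w
    ... | inj₂ c = inj₂ c
    ... | inj₁ r with On? (end G e i) (LoopErasure.erased r)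
    ...   | no u∉ = inj₁ (record
      { erased = step e i refl a erased
      ; simple = u∉ , simple
      ; on     = λ { _ (inj₁ eq) → inj₁ eq ; x (inj₂ x∈) → inj₂ (on x x∈) }
      ; same   = cong (t e xor_) same
      })
      where open LoopErasure r
    ...   | yes u∈ with t e xor weight t (Split.before (split _ _ u∈ (LoopErasure.simple r))) in eq
    ...     | true = inj₂ (record
      { e = e ; i = i ; inA = a ; back = before ; simple = before-simple ; odd = eq })
      where open Split (split _ _ u∈ (LoopErasure.simple r))
    ...     | false = inj₁ (record
      { erased = after
      ; simple = after-simple
      ; on     = λ x x∈ → inj₂ (on x (after-on x x∈))
      ; same   = begin
          weight t after
            ≡⟨ cong (_xor weight t after) eq ⟨
          (t e xor weight t before) xor weight t after
            ≡⟨ xor-assoc (t e) _ _ ⟩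
          t e xor (weight t before xor weight t after)
            ≡⟨ cong (t e xor_) weights ⟨
          t e xor weight t erased
            ≡⟨ cong (t e xor_) same ⟩
          t e xor weight t w ∎
      })
      where
      open LoopErasure r
      open Split (split _ _ u∈ simple)
      open ≡-Reasoning

    -- Otherwise loop erasure would end in a closed simple walk of odd weight, but that walk is
    -- empty.
    oddCycle : ∀ {u} (w : Walk u u) → weight t w ≡ true → OddCycle
    oddCycle w odd with eraseLoops w
    ... | inj₂ c = c
    ... | inj₁ r with () ← trans (sym odd)
      (trans (sym (LoopErasure.same r))
        (closed-simple-weight (LoopErasure.erased r) refl (LoopErasure.simple r)))

  weight-false : ∀ {u v} (w : Walk u v) → weight (const false) w ≡ false
  weight-false []               = refl
  weight-false (step _ _ _ _ w) = weight-false w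

  -- With all weights zero there is no odd cycle, so loop erasure succeeds.
  simplify : ∀ {u v} (w : Walk u v) → Σ[ w′ ∈ Walk u v ] Simple w′ × (∀ x → On x w′ → On x w)
  simplify w with eraseLoops (const false) w
  ... | inj₁ r = erased , simple , on
    where open LoopErasure r
  ... | inj₂ c with () ← trans (sym (OddCycle.odd c)) (weight-false (OddCycle.back c))

-- Long barbells

module Trimming (G : Graph) (A : Fin (nE G) → Bool) where
  open Walks G A
  open SimpleWalks G A

  module _ {S : V → Set} (S? : ∀ x → Dec (S x)) where

    -- The walk is stopped at its first vertex in `S`.
    trimEnd : ∀ {u v} (w : Walk u v) → S v →
      ∃[ v′ ] Σ[ w′ ∈ Walk u v′ ] S v′ × (∀ x → On x w′ → S x → x ≡ v′)
    trimEnd {u} [] sv = u , [] , sv , λ { _ refl _ → refl }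
    trimEnd {u} (step e i p a w) sv with S? u
    ... | yes su = u , [] , su , λ { _ refl _ → refl }
    ... | no ¬su with trimEnd w sv
    ...   | v′ , w′ , sv′ , only = v′ , step e i p a w′ , sv′ ,
      λ { _ (inj₁ refl) sx → contradiction sx ¬su ; x (inj₂ x∈) sx → only x x∈ sx }

    -- The rest of the walk is searched before `u` is tested, so the walk restarts at its last
    -- vertex in `S`.
    trimStart : ∀ {u v} (w : Walk u v) →
      (∀ x → On x w → ¬ S x)
      ⊎ (∃[ u′ ] Σ[ w′ ∈ Walk u′ v ] S u′ × (∀ x → On x w′ → S x → x ≡ u′) × (∀ x → On x w′ → On x w))
    trimStart {u} [] with S? u
    ... | yes su = inj₂ (u , [] , su , (λ x x≡u _ → x≡u) , λ _ x∈ → x∈)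
    ... | no ¬su = inj₁ λ { _ refl → ¬su }
    trimStart {u} (step e i p a w) with trimStart w
    ... | inj₂ (u′ , w′ , su′ , only , on) = inj₂ (u′ , w′ , su′ , only , λ x x∈ → inj₂ (on x x∈))
    ... | inj₁ none with S? u
    ...   | yes su = inj₂ (u , step e i p a w , su ,
      (λ { _ (inj₁ eq) _ → eq ; x (inj₂ x∈) sx → contradiction sx (none x x∈) }) , λ _ x∈ → x∈)
    ...   | no ¬su = inj₁ λ { _ (inj₁ refl) → ¬su ; x (inj₂ x∈) → none x x∈ }

  onCircuit? : ∀ (C : Circuit G) v → Dec (OnCircuit C v)
  onCircuit? C v = any? λ i → vert C (inject₁ i) ≟ v

  -- The walk is stopped at its first vertex on `C₂`, restarted at its last vertex on `C₁` and then
  -- made simple. The later operations only remove vertices, so what the earlier ones achieved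
  -- persists.
  connectCircuits : ∀ {σ : Signature G} (C₁ C₂ : Circuit G) → Unbalanced σ C₁ → Unbalanced σ C₂ →
    (∀ v → OnCircuit C₁ v → ¬ OnCircuit C₂ v) →
    ∀ {u v} → Walk u v → OnCircuit C₁ u → OnCircuit C₂ v → LongBarbell G σ
  connectCircuits C₁ C₂ unb₁ unb₂ disj w on₁ on₂ with trimEnd (onCircuit? C₂) w on₂
  ... | v′ , w₂ , on₂′ , only₂ with trimStart (onCircuit? C₁) w₂
  ...   | inj₁ none = contradiction on₁ (none _ (first-on w₂))
  ...   | inj₂ (u′ , w₁ , on₁′ , only₁ , on) with simplify w₁
  ...     | w₀ , s , on₀ = record
    { C₁ = C₁ ; C₂ = C₂ ; unb₁ = unb₁ ; unb₂ = unb₂ ; disj = disj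
    ; P = simplePath w₀ s
    ; start = subst (OnCircuit C₁) (sym (vertex-zero w₀)) on₁′
    ; stop  = subst (OnCircuit C₂) (sym (vertex-last w₀)) on₂′
    ; inner₁ = λ i i≢0 c → i≢0 (vertex-injective w₀ s
        (trans (only₁ _ (on₀ _ (vertex-on w₀ i)) c) (sym (vertex-zero w₀))))
    ; inner₂ = λ i i≢n c → i≢n (vertex-injective w₀ s
        (trans (only₂ _ (on _ (on₀ _ (vertex-on w₀ i))) c) (sym (vertex-last w₀))))
    }

TwoOf : (a b c : Bool) → Set
TwoOf a b c = (a ≡ true × b ≡ true) ⊎ (a ≡ true × c ≡ true) ⊎ (b ≡ true × c ≡ true)

even⇒TwoOf : ∀ a b c → a xor (b xor c) ≡ false → a ≡ true ⊎ b ≡ true ⊎ c ≡ true → TwoOf a b c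
even⇒TwoOf true  true  false _ _ = inj₁ (refl , refl)
even⇒TwoOf true  false true  _ _ = inj₂ (inj₁ (refl , refl))
even⇒TwoOf false true  true  _ _ = inj₂ (inj₂ (refl , refl))
even⇒TwoOf false false false _ (inj₂ (inj₁ ()))
even⇒TwoOf false false false _ (inj₂ (inj₂ ()))

-- Pigeonhole for the three half-edges at a cubic vertex. It turns edge-disjoint circuits into
-- vertex-disjoint ones.
TwoOf-meet : ∀ {a b c a′ b′ c′} → TwoOf a b c → TwoOf a′ b′ c′ →
  (a ≡ true × a′ ≡ true) ⊎ (b ≡ true × b′ ≡ true) ⊎ (c ≡ true × c′ ≡ true)
TwoOf-meet (inj₁ (a , b))        (inj₁ (a′ , b′))        = inj₁ (a , a′)
TwoOf-meet (inj₁ (a , b))        (inj₂ (inj₁ (a′ , c′))) = inj₁ (a , a′)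
TwoOf-meet (inj₁ (a , b))        (inj₂ (inj₂ (b′ , c′))) = inj₂ (inj₁ (b , b′))
TwoOf-meet (inj₂ (inj₁ (a , c))) (inj₁ (a′ , b′))        = inj₁ (a , a′)
TwoOf-meet (inj₂ (inj₁ (a , c))) (inj₂ (inj₁ (a′ , c′))) = inj₁ (a , a′)
TwoOf-meet (inj₂ (inj₁ (a , c))) (inj₂ (inj₂ (b′ , c′))) = inj₂ (inj₂ (c , c′))
TwoOf-meet (inj₂ (inj₂ (b , c))) (inj₁ (a′ , b′))        = inj₂ (inj₁ (b , b′))
TwoOf-meet (inj₂ (inj₂ (b , c))) (inj₂ (inj₁ (a′ , c′))) = inj₂ (inj₂ (c , c′))
TwoOf-meet (inj₂ (inj₂ (b , c))) (inj₂ (inj₂ (b′ , c′))) = inj₂ (inj₁ (b , b′))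

module _ (G : Graph) where

  onCircuit-halfEdge : ∀ (C : Circuit G) {X : Fin (nE G) → Bool} → (∀ i → X (edge C i) ≡ true) →
    ∀ {v} → OnCircuit C v → ∃[ h ] endOf G h ≡ v × X (proj₁ h) ≡ true
  onCircuit-halfEdge C C⊆X (i , refl) with joins C i
  ... | inj₁ (p , _) = (edge C i , zero) , p , C⊆X i
  ... | inj₂ (_ , p) = (edge C i , suc zero) , p , C⊆X i

  module _ {X v a b c} (even : EvenDegrees G X) (s : Star G v a b c) where

    even-star : X (proj₁ a) xor (X (proj₁ b) xor X (proj₁ c)) ≡ false
    even-star = trans (sym (star-sum G s xorMonoid (λ e _ → X e))) (even v)

    twoOfStar : ∃[ h ] endOf G h ≡ v × X (proj₁ h) ≡ true →
      TwoOf (X (proj₁ a)) (X (proj₁ b)) (X (proj₁ c))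
    twoOfStar (h , h-end , x) = even⇒TwoOf _ _ _ even-star (locate (star-cover G s h h-end))
      where
      locate : h ≡ a ⊎ h ≡ b ⊎ h ≡ c → X (proj₁ a) ≡ true ⊎ X (proj₁ b) ≡ true ⊎ X (proj₁ c) ≡ true
      locate (inj₁ refl)        = inj₁ x
      locate (inj₂ (inj₁ refl)) = inj₂ (inj₁ x)
      locate (inj₂ (inj₂ refl)) = inj₂ (inj₂ x)

-- Connected components and disjoint odd edge sets

module Components (G : Graph) where
  open Walks G (const true)
  private
    module P = Potential (potential (const false) (allFin (nE G)))

  abstract
    component : Fin (nV G) → Fin (nV G)
    component = P.label

    component-walk : ∀ {u v} → component u ≡ component v → Walk u v
    component-walk eq = proj₁ (P.connect _ _ eq)

    component-edge : ∀ e → component (end G e zero) ≡ component (end G e (suc zero))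
    component-edge e = P.joined (∈-allFin e) refl

  WithinComponent : Fin (nV G) → (Fin (nE G) → Bool) → Set
  WithinComponent κ X = ∀ e → X e ≡ true → component (end G e zero) ≡ κ

module _ (G : Graph) (σ : Signature G) where
  open Components G

  signSum : (Fin (nE G) → Bool) → Bool
  signSum X = ⊕.sum (λ e → X e ∧ isNegative (σ e))

  -- A potential for the signs on `X` would make the number of negative edges of `X` even. So there
  -- is an odd closed walk in `X`, and it contains an odd cycle.
  unbalancedCircuit : ∀ X → EvenDegrees G X → signSum X ≡ true →
    Σ[ C ∈ Circuit G ] Unbalanced σ C × (∀ i → X (edge C i) ≡ true)
  unbalancedCircuit X even odd with balancedOrOddClosedWalk (isNegative ∘ σ)
    where open Walks G X
  ... | inj₁ (p , balanced) with () ← trans (sym odd) (evenDegrees-balanced G even p balanced)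
  ... | inj₂ (u , w , w-odd) = circuit ,
      trans (negCount-parity σ circuit) (cong bit circuit-weight) , circuit-in
    where
    open SimpleWalks G X
    open OddCycle (oddCycle (isNegative ∘ σ) w w-odd)

  -- Each set contains an unbalanced circuit, and a walk inside the common component connects the
  -- two.
  disjointOddSets⇒barbell : Cubic G → ∀ {κ X₁ X₂} →
    EvenDegrees G X₁ → signSum X₁ ≡ true → WithinComponent κ X₁ →
    EvenDegrees G X₂ → signSum X₂ ≡ true → WithinComponent κ X₂ →
    (∀ e → X₁ e ≡ true → X₂ e ≢ true) → LongBarbell G σ
  disjointOddSets⇒barbell cubic {κ} {X₁} {X₂} even₁ odd₁ within₁ even₂ odd₂ within₂ disjoint
    with unbalancedCircuit X₁ even₁ odd₁ | unbalancedCircuit X₂ even₂ odd₂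
  ... | C₁ , unb₁ , C₁⊆X₁ | C₂ , unb₂ , C₂⊆X₂ =
    connectCircuits C₁ C₂ unb₁ unb₂ vertexDisjoint
      (component-walk (trans (inside within₁ (onCircuit-halfEdge G C₁ C₁⊆X₁ (proj₂ (somewhere C₁))))
        (sym (inside within₂ (onCircuit-halfEdge G C₂ C₂⊆X₂ (proj₂ (somewhere C₂)))))))
      (proj₂ (somewhere C₁)) (proj₂ (somewhere C₂))
    where
    open Trimming G (const true)
    somewhere : ∀ (C : Circuit G) → ∃[ v ] OnCircuit C v
    somewhere C with len C | len≥1 C | vert C
    ... | suc n | _ | f = f zero , zero , refl
    inside : ∀ {X v} → WithinComponent κ X → ∃[ h ] endOf G h ≡ v × X (proj₁ h) ≡ true → component v ≡ κ
    inside within ((e , zero) , refl , x)     = within e x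
    inside within ((e , suc zero) , refl , x) = trans (sym (component-edge e)) (within e x)
    -- Two edge-disjoint circuits through v would use four half-edges at v.
    vertexDisjoint : ∀ v → OnCircuit C₁ v → ¬ OnCircuit C₂ v
    vertexDisjoint v on₁ on₂ with cubicStar G cubic v
    ... | a , b , c , s with TwoOf-meet (twoOfStar G even₁ s (onCircuit-halfEdge G C₁ C₁⊆X₁ on₁))
                                        (twoOfStar G even₂ s (onCircuit-halfEdge G C₂ C₂⊆X₂ on₂))
    ...   | inj₁ (x₁ , x₂)        = disjoint _ x₁ x₂
    ...   | inj₂ (inj₁ (x₁ , x₂)) = disjoint _ x₁ x₂
    ...   | inj₂ (inj₂ (x₁ , x₂)) = disjoint _ x₁ x₂

  -- The complement of `Y` in `X` is again an even edge set, and its number of negative edges is odd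
  -- as a difference of an even and an odd number.
  oddEvenSubset⇒barbell : Cubic G → ∀ {κ X Y} → EvenDegrees G X → signSum X ≡ false →
    WithinComponent κ X → EvenDegrees G Y → signSum Y ≡ true →
    (∀ e → Y e ≡ true → X e ≡ true) → LongBarbell G σ
  oddEvenSubset⇒barbell cubic {κ} {X} {Y} evenX sumX within evenY sumY Y⊆X =
    disjointOddSets⇒barbell cubic evenY sumY (λ e y → within e (Y⊆X e y))
      evenRest sumRest (λ e r → within e (proj₁ (rest e (Y⊆X e) r)))
      (λ e y r → proj₂ (rest e (Y⊆X e) r) y)
    where
    rest : ∀ e → (Y e ≡ true → X e ≡ true) → X e xor Y e ≡ true → X e ≡ true × Y e ≢ true
    rest e sub r with X e | Y e
    ... | true  | false = refl , λ ()
    ... | false | true  = contradiction (sub refl) λ ()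
    evenRest : EvenDegrees G (λ e → X e xor Y e)
    evenRest v = trans (⊕.at-∙ G v (λ e _ → X e) (λ e _ → Y e)) (cong₂ _xor_ (evenX v) (evenY v))
    sumRest : signSum (λ e → X e xor Y e) ≡ true
    sumRest = trans (⊕.sum-cong {nE G} (λ e → ∧-distribʳ-xor (isNegative (σ e)) (X e) (Y e)))
      (trans (⊕.∑-distrib-+ (λ e → X e ∧ isNegative (σ e)) _) (cong₂ _xor_ sumX sumY))

-- From flows to colourings

-- The factor 2 has to be cancelled in ℕ, since modulo 2 all doubled counts vanish.
doubledCounts-parity : ∀ {m n} (f : Fin m → Bool) (g : Fin n → Bool) →
  ℕΣ.sum (λ i → bit (f i) ℕ.+ bit (f i)) ≡ ℕΣ.sum (λ j → bit (g j) ℕ.+ bit (g j)) →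
  ⊕.sum f ≡ ⊕.sum g
doubledCounts-parity {m} {n} f g doubled = bit-injective (begin
  bit (⊕.sum f)         ≡⟨ Σℕ-parity (bit ∘ f) f (λ _ → refl) ⟨
  Σℕ (bit ∘ f) % 2      ≡⟨ cong (_% 2) (Σℕ≡sum (bit ∘ f)) ⟩
  ℕΣ.sum (bit ∘ f) % 2  ≡⟨ cong (_% 2) (double-injective (ℕΣ.sum (bit ∘ f)) (ℕΣ.sum (bit ∘ g)) doubled′) ⟩
  ℕΣ.sum (bit ∘ g) % 2  ≡⟨ cong (_% 2) (Σℕ≡sum (bit ∘ g)) ⟨
  Σℕ (bit ∘ g) % 2      ≡⟨ Σℕ-parity (bit ∘ g) g (λ _ → refl) ⟩
  bit (⊕.sum g)         ∎)
  where
  open ≡-Reasoning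
  doubled′ : ℕΣ.sum (bit ∘ f) ℕ.+ ℕΣ.sum (bit ∘ f) ≡ ℕΣ.sum (bit ∘ g) ℕ.+ ℕΣ.sum (bit ∘ g)
  doubled′ = trans (sym (ℕΣ.∑-distrib-+ (bit ∘ f) (bit ∘ f)))
    (trans doubled (ℕΣ.∑-distrib-+ (bit ∘ g) (bit ∘ g)))
  bit-injective : ∀ {x y} → bit x ≡ bit y → x ≡ y
  bit-injective {true}  {true}  _ = refl
  bit-injective {false} {false} _ = refl
  double-injective : ∀ x y → x ℕ.+ x ≡ y ℕ.+ y → x ≡ y
  double-injective x y eq = ℕ.*-cancelˡ-≡ x y 2
    (trans (cong (x ℕ.+_) (ℕ.+-identityʳ x)) (trans eq (sym (cong (y ℕ.+_) (ℕ.+-identityʳ y)))))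

∂-star : ∀ G τ f {v a b c} → Star G v a b c → let value h = toℤ (τ (proj₁ h) (proj₂ h)) ℤ.* f (proj₁ h) in
  ∂ G τ f v ≡ value a ℤ.+ (value b ℤ.+ value c)
∂-star G τ f {v} s = trans (Σℤ≡sum (λ e → Σℤ (λ i → when ⌊ end G e i ≟ v ⌋ (φ e i))))
  (trans (sum-cong (λ e → Σℤ≡sum (λ i → when ⌊ end G e i ≟ v ⌋ (φ e i))))
    (star-sum G s ℤ.+-0-commutativeMonoid φ))
  where
  open ℤΣ
  φ : Fin (nE G) → Fin 2 → ℤ
  φ e i = toℤ (τ e i) ℤ.* f e

isOdd : Fin 4 → Bool
isOdd zero                   = false
isOdd (suc zero)             = true
isOdd (suc (suc zero))       = false
isOdd (suc (suc (suc zero))) = true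

-- For odd x this tells whether ± x is 3 rather than 1 modulo 4.
isThree : Sign → Fin 4 → Bool
isThree s x = isNegative s xor ⌊ x ≟ 3F ⌋

OnlyFirstEven : (s t u : Sign) (x y z : Fin 4) → Set
OnlyFirstEven s t u x y z =
  isOdd x ≡ false × isOdd y ≡ true × isOdd z ≡ true × isThree t y ≡ isThree u z

abstract
  -- By parity, one or three of the values are even, hence equal to 2; three of them would sum to 2
  -- modulo 4. With a single 2, the two odd terms sum to 2 modulo 4 and are therefore congruent. All
  -- cases are checked by computation.
  zeroSum⇒oneEven : ∀ s t u x y z → x ≢ zero → y ≢ zero → z ≢ zero →
    4 ℕ.∣ ∣ toℤ s ℤ.* + toℕ x ℤ.+ (toℤ t ℤ.* + toℕ y ℤ.+ toℤ u ℤ.* + toℕ z) ∣ →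
    OnlyFirstEven s t u x y z ⊎ OnlyFirstEven t s u y x z ⊎ OnlyFirstEven u s t z x y
  zeroSum⇒oneEven = from-yes
    (allSign? λ s → allSign? λ t → allSign? λ u → all? λ x → all? λ y → all? λ z →
      ¬? (x ≟ zero) →-dec ¬? (y ≟ zero) →-dec ¬? (z ≟ zero) →-dec
      (4 ℕ.∣? ∣ toℤ s ℤ.* + toℕ x ℤ.+ (toℤ t ℤ.* + toℕ y ℤ.+ toℤ u ℤ.* + toℕ z) ∣) →-dec
      (onlyFirstEven? s t u x y z ⊎-dec onlyFirstEven? t s u y x z ⊎-dec onlyFirstEven? u s t z x y))
    where
    allSign? : ∀ {P : Sign → Set} → (∀ s → Dec (P s)) → Dec (∀ s → P s)
    allSign? P? = map′ (λ { (p , n) pos → p ; (p , n) neg → n }) (λ f → f pos , f neg) (P? pos ×-dec P? neg)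
    onlyFirstEven? : ∀ s t u x y z → Dec (OnlyFirstEven s t u x y z)
    onlyFirstEven? s t u x y z = (isOdd x Bool.≟ false) ×-dec (isOdd y Bool.≟ true) ×-dec
      (isOdd z Bool.≟ true) ×-dec (isThree t y Bool.≟ isThree u z)

-- For the 2-factor X of odd values of a ℤ₄-flow, g records which half-edges carry 3 rather than 1.
record TwoFactorStar (G : Graph) (X : Fin (nE G) → Bool) (g : Fin (nE G) → Fin 2 → Bool)
                     (v : Fin (nV G)) : Set where
  field
    a b c  : HalfEdge G
    star   : Star G v a b c
    a∉X    : X (proj₁ a) ≡ false
    b∈X    : X (proj₁ b) ≡ true
    c∈X    : X (proj₁ c) ≡ true
    agree  : g (proj₁ b) (proj₂ b) ≡ g (proj₁ c) (proj₂ c)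

-- Along a circuit of `X`, `g` changes exactly on the positive edges (`g-edge`) and stays the same
-- across vertices (`agree`). So the number of positive edges is even.
module TwoFactor (G : Graph) (σ : Signature G) (cubic : Cubic G)
  (X : Fin (nE G) → Bool) (g : Fin (nE G) → Fin 2 → Bool)
  (g-edge : ∀ e → g e zero xor g e (suc zero) ≡ not (isNegative (σ e)))
  (stars : ∀ v → TwoFactorStar G X g v) where

  open Components G

  private
    V E : Set
    V = Fin (nV G)
    E = Fin (nE G)

  -- As `X` is 2-regular, such a `W` is the vertex set of a union of circuits of `X`; `X-on W` is
  -- the edge set of this union.
  Closed : (V → Bool) → Set
  Closed W = ∀ e → X e ≡ true → W (end G e zero) ≡ W (end G e (suc zero))

  X-on : (V → Bool) → E → Bool
  X-on W e = X e ∧ W (end G e zero)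

  module _ {W : V → Bool} (closed : Closed W) where

    X-on-end : ∀ e i → X-on W e ≡ W (end G e i) ∧ X e
    X-on-end e zero = ∧-comm (X e) _
    X-on-end e (suc zero) with X e | closed e
    ... | true  | eq = trans (eq refl) (sym (∧-identityʳ (W (end G e (suc zero)))))
    ... | false | _  = sym (∧-zeroʳ (W (end G e (suc zero))))

    X-on-even : EvenDegrees G (X-on W)
    X-on-even v = begin
      ⊕.at G v (λ e _ → X-on W e)
        ≡⟨ ⊕.at-cong G v (λ e i _ → X-on-end e i) ⟩
      ⊕.at G v (λ e i → W (end G e i) ∧ X e)
        ≡⟨ at-∧ G v W (λ e _ → X e) ⟩
      W v ∧ ⊕.at G v (λ e _ → X e)
        ≡⟨ cong (W v ∧_) (star-sum G star xorMonoid (λ e _ → X e)) ⟩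
      W v ∧ (X (proj₁ a) xor (X (proj₁ b) xor X (proj₁ c)))
        ≡⟨ cong (W v ∧_) (cong₂ _xor_ a∉X (cong₂ _xor_ b∈X c∈X)) ⟩
      W v ∧ false
        ≡⟨ ∧-zeroʳ (W v) ⟩
      false ∎
      where
      open ≡-Reasoning
      open TwoFactorStar (stars v)

    -- Every vertex of `W` has two half-edges in `X`, so twice the number of edges is twice the
    -- number of vertices.
    X-on-count : ⊕.sum (X-on W) ≡ ⊕.sum W
    X-on-count = doubledCounts-parity (X-on W) W (begin
      ℕΣ.sum (λ e → bit (X-on W e) ℕ.+ bit (X-on W e))
        ≡⟨ ℕΣ.handshake G (λ e i → bit (X-on W e)) ⟨
      ℕΣ.sum (λ v → ℕΣ.at G v (λ e i → bit (X-on W e)))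
        ≡⟨ ℕΣ.sum-cong {nV G} local ⟩
      ℕΣ.sum (λ v → bit (W v) ℕ.+ bit (W v)) ∎)
      where
      open ≡-Reasoning
      local : ∀ v → ℕΣ.at G v (λ e i → bit (X-on W e)) ≡ bit (W v) ℕ.+ bit (W v)
      local v = begin
        ℕΣ.at G v (λ e i → bit (X-on W e))
          ≡⟨ ℕΣ.at-cong G v {ψ = λ e i → bit (W v ∧ X e)} (λ { e i refl → cong bit (X-on-end e i) }) ⟩
        ℕΣ.at G v (λ e i → bit (W v ∧ X e))
          ≡⟨ star-sum G star ℕ.+-0-commutativeMonoid (λ e _ → bit (W v ∧ X e)) ⟩
        bit (W v ∧ X (proj₁ a)) ℕ.+ (bit (W v ∧ X (proj₁ b)) ℕ.+ bit (W v ∧ X (proj₁ c)))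
          ≡⟨ cong₂ ℕ._+_ (in-X a∉X) (cong₂ ℕ._+_ (in-X b∈X) (in-X c∈X)) ⟩
        bit (W v ∧ false) ℕ.+ (bit (W v ∧ true) ℕ.+ bit (W v ∧ true))
          ≡⟨ simplified (W v) ⟩
        bit (W v) ℕ.+ bit (W v) ∎
        where
        open TwoFactorStar (stars v)
        in-X : ∀ {e b} → X e ≡ b → bit (W v ∧ X e) ≡ bit (W v ∧ b)
        in-X = cong (λ x → bit (W v ∧ x))
        simplified : ∀ w → bit (w ∧ false) ℕ.+ (bit (w ∧ true) ℕ.+ bit (w ∧ true)) ≡ bit w ℕ.+ bit w
        simplified true  = refl
        simplified false = refl

    -- On an edge of `X`, being negative is 1 plus the change of `g`. The ones count edges, which
    -- are as many as the vertices, and the values of `g` cancel in pairs at each vertex by `agree`.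
    X-on-signSum : signSum G σ (X-on W) ≡ ⊕.sum W
    X-on-signSum = begin
      ⊕.sum (λ e → X-on W e ∧ isNegative (σ e))
        ≡⟨ ⊕.sum-cong {nE G} resolve ⟩
      ⊕.sum (λ e → X-on W e xor (ψ e zero xor ψ e (suc zero)))
        ≡⟨ ⊕.∑-distrib-+ (X-on W) (λ e → ψ e zero xor ψ e (suc zero)) ⟩
      ⊕.sum (X-on W) xor ⊕.sum (λ e → ψ e zero xor ψ e (suc zero))
        ≡⟨ cong₂ _xor_ X-on-count (sym (⊕.handshake G ψ)) ⟩
      ⊕.sum W xor ⊕.sum (λ v → ⊕.at G v ψ)
        ≡⟨ cong (⊕.sum W xor_) (sum-false {nV G} local) ⟩
      ⊕.sum W xor false
        ≡⟨ xor-identityʳ (⊕.sum W) ⟩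
      ⊕.sum W ∎
      where
      open ≡-Reasoning
      ψ : E → Fin 2 → Bool
      ψ e i = W (end G e i) ∧ (X e ∧ g e i)
      resolve : ∀ e → X-on W e ∧ isNegative (σ e) ≡ X-on W e xor (ψ e zero xor ψ e (suc zero))
      resolve e with X e | closed e
      ... | false | _ = sym (cong₂ _xor_ (∧-zeroʳ (W (end G e zero))) (∧-zeroʳ (W (end G e (suc zero)))))
      ... | true  | closed-e with W (end G e zero) | W (end G e (suc zero)) | closed-e refl
      ...   | false | false | refl = refl
      ...   | true  | true  | refl = flip-not (isNegative (σ e)) (g-edge e)
        where
        flip-not : ∀ s {x} → x ≡ not s → s ≡ not x
        flip-not true  refl = refl
        flip-not false refl = refl
      local : ∀ v → ⊕.at G v ψ ≡ false
      local v = begin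
        ⊕.at G v ψ
          ≡⟨ at-∧ G v W (λ e i → X e ∧ g e i) ⟩
        W v ∧ ⊕.at G v (λ e i → X e ∧ g e i)
          ≡⟨ cong (W v ∧_) (star-sum G star xorMonoid (λ e i → X e ∧ g e i)) ⟩
        W v ∧ ((X (proj₁ a) ∧ g (proj₁ a) (proj₂ a))
          xor ((X (proj₁ b) ∧ g (proj₁ b) (proj₂ b)) xor (X (proj₁ c) ∧ g (proj₁ c) (proj₂ c))))
          ≡⟨ cong (W v ∧_) (cong₂ _xor_ (cong (_∧ _) a∉X)
               (cong₂ _xor_ (cong₂ _∧_ b∈X agree) (cong (_∧ _) c∈X))) ⟩
        W v ∧ (g (proj₁ c) (proj₂ c) xor g (proj₁ c) (proj₂ c))
          ≡⟨ cong (W v ∧_) (xor-same (g (proj₁ c) (proj₂ c))) ⟩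
        W v ∧ false
          ≡⟨ ∧-zeroʳ (W v) ⟩
        false ∎
        where open TwoFactorStar (stars v)

  -- The complement of X is a perfect matching.
  union-of-components-even : ∀ (W : V → Bool) → (∀ e → W (end G e zero) ≡ W (end G e (suc zero))) →
    ⊕.sum W ≡ false
  union-of-components-even W closed = begin
    ⊕.sum W
      ≡⟨ ⊕.sum-cong {nV G} local ⟨
    ⊕.sum (λ v → ⊕.at G v ψ)
      ≡⟨ ⊕.handshake G ψ ⟩
    ⊕.sum (λ e → ψ e zero xor ψ e (suc zero))
      ≡⟨ sum-false {nE G} (λ e → trans (cong (λ w → (w ∧ not (X e)) xor ψ e (suc zero)) (closed e))
           (xor-same (ψ e (suc zero)))) ⟩
    false ∎
    where
    open ≡-Reasoning
    ψ : E → Fin 2 → Bool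
    ψ e i = W (end G e i) ∧ not (X e)
    local : ∀ v → ⊕.at G v ψ ≡ W v
    local v = begin
      ⊕.at G v ψ
        ≡⟨ at-∧ G v W (λ e _ → not (X e)) ⟩
      W v ∧ ⊕.at G v (λ e _ → not (X e))
        ≡⟨ cong (W v ∧_) (star-sum G star xorMonoid (λ e _ → not (X e))) ⟩
      W v ∧ (not (X (proj₁ a)) xor (not (X (proj₁ b)) xor not (X (proj₁ c))))
        ≡⟨ cong (W v ∧_) (cong₂ (λ x y → not x xor y) a∉X (cong₂ (λ x y → not x xor not y) b∈X c∈X)) ⟩
      W v ∧ true
        ≡⟨ ∧-identityʳ (W v) ⟩
      W v ∎
      where open TwoFactorStar (stars v)

  inComponent : V → V → Bool
  inComponent κ v = ⌊ component v ≟ κ ⌋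

  -- Alternating colourings of the circuits of X are potentials of the graph whose
  -- nodes are the edges of G and whose links are the vertices of G.
  dual : Graph
  dual = record { nV = nE G ; nE = nV G ; end = ends }
    where
    ends : V → Fin 2 → E
    ends v zero       = proj₁ (TwoFactorStar.b (stars v))
    ends v (suc zero) = proj₁ (TwoFactorStar.c (stars v))

  -- For `e` in `X`, the degree of the node `e` in `Y` is the number of half-edges of `e` at
  -- vertices of `Y`. If it is even, both ends of `e` belong to `Y` or neither does.
  dual-closed : ∀ Y → EvenDegrees dual Y → Closed Y
  dual-closed Y even e e∈X = xor-false (begin
    Y (end G e zero) xor Y (end G e (suc zero))
      ≡⟨ cong₂ _xor_ (in-X zero) (in-X (suc zero)) ⟩
    φ e zero xor φ e (suc zero)
      ≡⟨ sum-delta e (λ e′ → φ e′ zero xor φ e′ (suc zero)) ⟨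
    ⊕.sum (λ e′ → ⌊ e ≟ e′ ⌋ ∧ (φ e′ zero xor φ e′ (suc zero)))
      ≡⟨ ⊕.sum-cong {nE G} (λ e′ → ∧-distribˡ-xor ⌊ e ≟ e′ ⌋ (φ e′ zero) (φ e′ (suc zero))) ⟩
    ⊕.sum (λ e′ → ψ e′ zero xor ψ e′ (suc zero))
      ≡⟨ ⊕.handshake G ψ ⟨
    ⊕.sum (λ v → ⊕.at G v ψ)
      ≡⟨ ⊕.sum-cong {nV G} local ⟩
    ⊕.at dual e (λ v _ → Y v)
      ≡⟨ even e ⟩
    false ∎)
    where
    open ≡-Reasoning
    φ ψ : E → Fin 2 → Bool
    φ e′ i = X e′ ∧ Y (end G e′ i)
    ψ e′ i = ⌊ e ≟ e′ ⌋ ∧ φ e′ i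
    in-X : ∀ i → Y (end G e i) ≡ φ e i
    in-X i = cong (_∧ Y (end G e i)) (sym e∈X)
    xor-false : ∀ {x y} → x xor y ≡ false → x ≡ y
    xor-false {true}  {true}  _ = refl
    xor-false {false} {false} _ = refl
    link : ∀ e′ y → ⌊ e ≟ e′ ⌋ ∧ y ≡ ⊕.when ⌊ e′ ≟ e ⌋ y
    link e′ y with e ≟ e′ | e′ ≟ e
    ... | yes _ | yes _ = refl
    ... | no _  | no _  = refl
    ... | yes p | no ¬p = contradiction (sym p) ¬p
    ... | no ¬p | yes p = contradiction (sym p) ¬p
    local : ∀ v → ⊕.at G v ψ ≡ ⊕.sum (λ i → ⊕.when ⌊ end dual v i ≟ e ⌋ (Y v))
    local v = begin
      ⊕.at G v ψ
        ≡⟨ ⊕.at-cong G v {ψ} {λ e′ _ → ⌊ e ≟ e′ ⌋ ∧ (X e′ ∧ Y v)} (λ { e′ i refl → refl }) ⟩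
      ⊕.at G v (λ e′ _ → ⌊ e ≟ e′ ⌋ ∧ (X e′ ∧ Y v))
        ≡⟨ star-sum G star xorMonoid (λ e′ _ → ⌊ e ≟ e′ ⌋ ∧ (X e′ ∧ Y v)) ⟩
      (⌊ e ≟ proj₁ a ⌋ ∧ (X (proj₁ a) ∧ Y v))
        xor ((⌊ e ≟ proj₁ b ⌋ ∧ (X (proj₁ b) ∧ Y v)) xor (⌊ e ≟ proj₁ c ⌋ ∧ (X (proj₁ c) ∧ Y v)))
        ≡⟨ cong₂ _xor_ (trans (cong (λ x → ⌊ e ≟ proj₁ a ⌋ ∧ (x ∧ Y v)) a∉X) (∧-zeroʳ ⌊ e ≟ proj₁ a ⌋))
             (cong₂ _xor_ (trans (cong (λ x → ⌊ e ≟ proj₁ b ⌋ ∧ (x ∧ Y v)) b∈X) (link _ (Y v)))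
                          (trans (cong (λ x → ⌊ e ≟ proj₁ c ⌋ ∧ (x ∧ Y v)) c∈X) (link _ (Y v)))) ⟩
      ⊕.when ⌊ proj₁ b ≟ e ⌋ (Y v) xor ⊕.when ⌊ proj₁ c ≟ e ⌋ (Y v)
        ≡⟨ cong (⊕.when ⌊ proj₁ b ≟ e ⌋ (Y v) xor_) (xor-identityʳ _) ⟨
      ⊕.sum (λ i → ⊕.when ⌊ end dual v i ≟ e ⌋ (Y v)) ∎
      where open TwoFactorStar (stars v)

  -- An obstruction `Y` is a union of circuits of `X` with an odd number of vertices, hence of
  -- negative edges. The edges of `X` in the whole component contain an even number of negative
  -- ones, because the component has an even number of vertices; this would give a long barbell.
  alternating : ¬ LongBarbell G σ → ∀ κ → Σ[ k ∈ (E → Bool) ] ∀ v → component v ≡ κ →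
    let open TwoFactorStar (stars v) in k (proj₁ b) xor k (proj₁ c) ≡ true
  alternating noBarbell κ with balancedOrOddEvenSubset dual (inComponent κ) (const true)
  ... | inj₁ (k , alternates) = k , λ v v∈κ → alternates v (here-in v v∈κ)
    where
    here-in : ∀ v → component v ≡ κ → inComponent κ v ≡ true
    here-in v v∈κ with component v ≟ κ
    ... | yes _ = refl
    ... | no ¬p = contradiction v∈κ ¬p
  ... | inj₂ (Y , even , Y⊆κ , odd) = contradiction
    (oddEvenSubset⇒barbell G σ cubic {κ} (X-on-even {inComponent κ} κ-closed)
      (trans (X-on-signSum {inComponent κ} κ-closed) (union-of-components-even (inComponent κ) κ-closed′))
      (λ e x → inside e (proj₂ (∧-true {X e} x)))
      (X-on-even {Y} Y-closed)
      (trans (X-on-signSum {Y} Y-closed) (trans (⊕.sum-cong {nV G} (λ v → sym (∧-identityʳ (Y v)))) odd))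
      (λ e y → cong₂ _∧_ (proj₁ (∧-true {X e} y)) (Y⊆κ (end G e zero) (proj₂ (∧-true {X e} y)))))
    noBarbell
    where
    κ-closed′ : ∀ e → inComponent κ (end G e zero) ≡ inComponent κ (end G e (suc zero))
    κ-closed′ e = cong (λ x → ⌊ x ≟ κ ⌋) (component-edge e)
    κ-closed : Closed (inComponent κ)
    κ-closed e _ = κ-closed′ e
    Y-closed : Closed Y
    Y-closed = dual-closed Y even
    ∧-true : ∀ {x y} → x ∧ y ≡ true → x ≡ true × y ≡ true
    ∧-true {true} {true} _ = refl , refl
    inside : ∀ e → inComponent κ (end G e zero) ≡ true → component (end G e zero) ≡ κ
    inside e p with yes q ← component (end G e zero) ≟ κ = q

  colorable : ¬ LongBarbell G σ → ThreeEdgeColorable G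
  colorable noBarbell = color , proper
    where
    k : V → E → Bool
    k κ = proj₁ (alternating noBarbell κ)
    paint : Bool → Bool → Fin 3
    paint true  true  = zero
    paint true  false = suc zero
    paint false _     = suc (suc zero)
    color : E → Fin 3
    -- Each component has its own alternating colouring, so an edge looks up the one of its
    -- component.
    color e = paint (X e) (k (component (end G e zero)) e)
    color-at : ∀ v h → endOf G h ≡ v → color (proj₁ h) ≡ paint (X (proj₁ h)) (k (component v) (proj₁ h))
    color-at v (e , zero)     refl = refl
    color-at v (e , suc zero) refl = cong (λ κ → paint (X e) (k κ e)) (component-edge e)
    outside≢inside : ∀ {x y} p q → x ≡ false → y ≡ true → paint x p ≢ paint y q
    outside≢inside p true  refl refl ()
    outside≢inside p false refl refl ()
    inside≢inside : ∀ {x y} p q → x ≡ true → y ≡ true → p xor q ≡ true → paint x p ≢ paint y q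
    inside≢inside true  false refl refl _ ()
    inside≢inside false true  refl refl _ ()
    proper : ∀ e e′ i i′ → ¬ (e ≡ e′ × i ≡ i′) → end G e i ≡ end G e′ i′ → color e ≢ color e′
    proper e e′ i i′ distinct same eq = differ
      (λ h≡h′ → distinct (cong proj₁ h≡h′ , cong proj₂ h≡h′))
      (star-cover G star (e , i) refl) (star-cover G star (e′ , i′) (sym same))
      (trans (sym (color-at v (e , i) refl)) (trans eq (color-at v (e′ , i′) (sym same))))
      where
      v : V
      v = end G e i
      open TwoFactorStar (stars v)
      kv : HalfEdge G → Bool
      kv h = k (component v) (proj₁ h)
      bc : kv b xor kv c ≡ true
      bc = proj₂ (alternating noBarbell (component v)) v refl
      cb : kv c xor kv b ≡ true
      cb = trans (xor-comm (kv c) (kv b)) bc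
      differ : ∀ {h h′} → h ≢ h′ → h ≡ a ⊎ h ≡ b ⊎ h ≡ c → h′ ≡ a ⊎ h′ ≡ b ⊎ h′ ≡ c →
        paint (X (proj₁ h)) (kv h) ≢ paint (X (proj₁ h′)) (kv h′)
      differ h≢h′ (inj₁ refl)        (inj₁ refl)        = contradiction refl h≢h′
      differ h≢h′ (inj₁ refl)        (inj₂ (inj₁ refl)) = outside≢inside (kv a) (kv b) a∉X b∈X
      differ h≢h′ (inj₁ refl)        (inj₂ (inj₂ refl)) = outside≢inside (kv a) (kv c) a∉X c∈X
      differ h≢h′ (inj₂ (inj₁ refl)) (inj₁ refl)        = outside≢inside (kv a) (kv b) a∉X b∈X ∘ sym
      differ h≢h′ (inj₂ (inj₁ refl)) (inj₂ (inj₁ refl)) = contradiction refl h≢h′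
      differ h≢h′ (inj₂ (inj₁ refl)) (inj₂ (inj₂ refl)) = inside≢inside (kv b) (kv c) b∈X c∈X bc
      differ h≢h′ (inj₂ (inj₂ refl)) (inj₁ refl)        = outside≢inside (kv a) (kv c) a∉X c∈X ∘ sym
      differ h≢h′ (inj₂ (inj₂ refl)) (inj₂ (inj₁ refl)) = inside≢inside (kv c) (kv b) c∈X b∈X cb
      differ h≢h′ (inj₂ (inj₂ refl)) (inj₂ (inj₂ refl)) = contradiction refl h≢h′

flow⇒colorable : ∀ G σ → Cubic G → ¬ LongBarbell G σ → HasNZℤ₄Flow G σ → ThreeEdgeColorable G
flow⇒colorable G σ cubic noBarbell (τ , f , orientation , nonzero , conserved) =
  TwoFactor.colorable G σ cubic (isOdd ∘ f) residue residue-edge stars noBarbell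
  where
  residue : Fin (nE G) → Fin 2 → Bool
  residue e i = isThree (τ e i) (f e)
  -- The value `f e` enters at both half-edges and cancels. What remains are the orientation signs,
  -- which differ exactly on positive edges.
  residue-edge : ∀ e → residue e zero xor residue e (suc zero) ≡ not (isNegative (σ e))
  residue-edge e = orient (τ e zero) (τ e (suc zero)) (σ e) ⌊ f e ≟ 3F ⌋ (orientation e)
    where
    orient : ∀ s t u b → s · t ≡ negate u → (isNegative s xor b) xor (isNegative t xor b) ≡ not (isNegative u)
    orient pos pos neg false _ = refl
    orient pos pos neg true  _ = refl
    orient pos neg pos false _ = refl
    orient pos neg pos true  _ = refl
    orient neg pos pos false _ = refl
    orient neg pos pos true  _ = refl
    orient neg neg neg false _ = refl
    orient neg neg neg true  _ = refl
  stars : ∀ v → TwoFactorStar G (isOdd ∘ f) residue v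
  stars v with cubicStar G cubic v
  ... | a , b , c , s with zeroSum⇒oneEven (sign a) (sign b) (sign c)
      (f (proj₁ a)) (f (proj₁ b)) (f (proj₁ c))
      (nonzero _) (nonzero _) (nonzero _)
      (subst (λ z → 4 ℕ.∣ ∣ z ∣) (∂-star G τ (λ e → + toℕ (f e)) s) (conserved v))
    where
    sign : HalfEdge G → Sign
    sign h = τ (proj₁ h) (proj₂ h)
  ...   | inj₁ (p , q , r , eq) = record { star = s ; a∉X = p ; b∈X = q ; c∈X = r ; agree = eq }
  ...   | inj₂ (inj₁ (p , q , r , eq)) = record
    { star = star-swap₁₂ G s ; a∉X = p ; b∈X = q ; c∈X = r ; agree = eq }
  ...   | inj₂ (inj₂ (p , q , r , eq)) = record
    { star = star-swap₁₂ G (star-swap₂₃ G s) ; a∉X = p ; b∈X = q ; c∈X = r ; agree = eq }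

-- From colourings to flows

record ColoredStar (G : Graph) (c : Fin (nE G) → Fin 3) (v : Fin (nV G)) : Set where
  field
    h      : Fin 3 → HalfEdge G
    star   : Star G v (h 0F) (h 1F) (h 2F)
    color  : ∀ i → c (proj₁ (h i)) ≡ i

Permuted : (x y z : Fin 3) → Set
Permuted x y z =
  (x ≡ 0F × y ≡ 1F × z ≡ 2F) ⊎ (x ≡ 0F × y ≡ 2F × z ≡ 1F) ⊎ (x ≡ 1F × y ≡ 0F × z ≡ 2F) ⊎
  (x ≡ 1F × y ≡ 2F × z ≡ 0F) ⊎ (x ≡ 2F × y ≡ 0F × z ≡ 1F) ⊎ (x ≡ 2F × y ≡ 1F × z ≡ 0F)

abstract
  distinct⇒Permuted : ∀ (x y z : Fin 3) → x ≢ y → x ≢ z → y ≢ z → Permuted x y z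
  distinct⇒Permuted = from-yes (all? λ x → all? λ y → all? λ z →
    ¬? (x ≟ y) →-dec ¬? (x ≟ z) →-dec ¬? (y ≟ z) →-dec
    (are? x y z 0F 1F 2F ⊎-dec are? x y z 0F 2F 1F ⊎-dec are? x y z 1F 0F 2F ⊎-dec
     are? x y z 1F 2F 0F ⊎-dec are? x y z 2F 0F 1F ⊎-dec are? x y z 2F 1F 0F))
    where
    are? : ∀ (x y z i j k : Fin 3) → Dec (x ≡ i × y ≡ j × z ≡ k)
    are? x y z i j k = (x ≟ i) ×-dec (y ≟ j) ×-dec (z ≟ k)

-- The cyclic shift, so that `next m` and `next (next m)` are the two colours other than `m`.
next : Fin 3 → Fin 3
next 0F = 1F
next 1F = 2F
next 2F = 0F

splitColors : ∀ m x y → (y ≡ true → x ≢ m) → y ≡ (⌊ x ≟ next m ⌋ ∧ y) xor (⌊ x ≟ next (next m) ⌋ ∧ y)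
splitColors 0F 0F true  miss = contradiction refl (miss refl)
splitColors 0F 1F true  _ = refl
splitColors 0F 2F true  _ = refl
splitColors 1F 0F true  _ = refl
splitColors 1F 1F true  miss = contradiction refl (miss refl)
splitColors 1F 2F true  _ = refl
splitColors 2F 0F true  _ = refl
splitColors 2F 1F true  _ = refl
splitColors 2F 2F true  miss = contradiction refl (miss refl)
splitColors m  x  false _ = sym (cong₂ _xor_ (∧-zeroʳ ⌊ x ≟ next m ⌋) (∧-zeroʳ ⌊ x ≟ next (next m) ⌋))

othersEqual : ∀ m (y : Fin 3 → Bool) → y 0F xor (y 1F xor y 2F) ≡ false → y m ≡ false →
  y (next m) ≡ y (next (next m))
othersEqual 0F y zeroSum eq = first (y 0F) (y 1F) (y 2F) zeroSum eq
  where
  first : ∀ a b c → a xor (b xor c) ≡ false → a ≡ false → b ≡ c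
  first false true  true  _ _ = refl
  first false false false _ _ = refl
othersEqual 1F y zeroSum eq = second (y 0F) (y 1F) (y 2F) zeroSum eq
  where
  second : ∀ a b c → a xor (b xor c) ≡ false → b ≡ false → c ≡ a
  second true  false true  _ _ = refl
  second false false false _ _ = refl
othersEqual 2F y zeroSum eq = third (y 0F) (y 1F) (y 2F) zeroSum eq
  where
  third : ∀ a b c → a xor (b xor c) ≡ false → c ≡ false → a ≡ b
  third true  true  false _ _ = refl
  third false false false _ _ = refl

module Colored (G : Graph) (σ : Signature G) (cubic : Cubic G) (c : Fin (nE G) → Fin 3)
  (proper : ∀ e e′ i i′ → ¬ (e ≡ e′ × i ≡ i′) → end G e i ≡ end G e′ i′ → c e ≢ c e′) where

  open Components G

  private
    V E : Set
    V = Fin (nV G)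
    E = Fin (nE G)

  abstract
    coloredStar : ∀ v → ColoredStar G c v
    coloredStar v with cubicStar G cubic v
    ... | x , y , z , s = sort
      (distinct⇒Permuted _ _ _ (differ x≢y xv yv) (differ x≢z xv zv) (differ y≢z yv zv))
      where
      x≢y : x ≢ y
      x≢y = proj₁ (star-distinct G s)
      x≢z : x ≢ z
      x≢z = proj₁ (proj₂ (star-distinct G s))
      y≢z : y ≢ z
      y≢z = proj₂ (proj₂ (star-distinct G s))
      xv : endOf G x ≡ v
      xv = star-end G s (here refl)
      yv : endOf G y ≡ v
      yv = star-end G s (there (here refl))
      zv : endOf G z ≡ v
      zv = star-end G s (there (there (here refl)))
      differ : ∀ {h h′} → h ≢ h′ → endOf G h ≡ v → endOf G h′ ≡ v → c (proj₁ h) ≢ c (proj₁ h′)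
      differ h≢h′ p q = proper _ _ _ _ (λ { (refl , refl) → h≢h′ refl }) (trans p (sym q))
      triple : (x y z : HalfEdge G) → Fin 3 → HalfEdge G
      triple x y z 0F = x
      triple x y z 1F = y
      triple x y z 2F = z
      build : ∀ {x y z} → Star G v x y z → c (proj₁ x) ≡ 0F → c (proj₁ y) ≡ 1F → c (proj₁ z) ≡ 2F →
        ColoredStar G c v
      build {x} {y} {z} s p q r = record
        { h = triple x y z ; star = s ; color = λ { 0F → p ; 1F → q ; 2F → r } }
      swap₁₂ : ∀ {x y z} → Star G v x y z → Star G v y x z
      swap₁₂ = star-swap₁₂ G
      swap₂₃ : ∀ {x y z} → Star G v x y z → Star G v x z y
      swap₂₃ = star-swap₂₃ G
      sort : Permuted (c (proj₁ x)) (c (proj₁ y)) (c (proj₁ z)) → ColoredStar G c v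
      sort (inj₁ (p , q , r))                             = build s p q r
      sort (inj₂ (inj₁ (p , q , r)))                      = build (swap₂₃ s) p r q
      sort (inj₂ (inj₂ (inj₁ (p , q , r))))               = build (swap₁₂ s) q p r
      sort (inj₂ (inj₂ (inj₂ (inj₁ (p , q , r)))))        = build (swap₁₂ (swap₂₃ s)) r p q
      sort (inj₂ (inj₂ (inj₂ (inj₂ (inj₁ (p , q , r)))))) = build (swap₂₃ (swap₁₂ s)) q r p
      sort (inj₂ (inj₂ (inj₂ (inj₂ (inj₂ (p , q , r)))))) = build (swap₁₂ (swap₂₃ (swap₁₂ s))) r q p

  module _ (κ : V) where

    inside : V → Bool
    inside v = ⌊ component v ≟ κ ⌋

    avoiding : Fin 3 → E → Bool
    avoiding m e = inside (end G e zero) ∧ not ⌊ c e ≟ m ⌋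

    avoiding-within : ∀ m → WithinComponent κ (avoiding m)
    avoiding-within m e p with yes q ← component (end G e zero) ≟ κ = q

    avoiding-color : ∀ m e → avoiding m e ≡ true → c e ≢ m
    avoiding-color m e p q with inside (end G e zero) | c e ≟ m
    ... | true | no ¬q = ¬q q

    avoiding-even : ∀ m → EvenDegrees G (avoiding m)
    avoiding-even m v = begin
      ⊕.at G v (λ e _ → avoiding m e)
        ≡⟨ ⊕.at-cong G v (λ e i _ → at-end e i) ⟩
      ⊕.at G v (λ e i → inside (end G e i) ∧ not ⌊ c e ≟ m ⌋)
        ≡⟨ at-∧ G v inside (λ e _ → not ⌊ c e ≟ m ⌋) ⟩
      inside v ∧ ⊕.at G v (λ e _ → not ⌊ c e ≟ m ⌋)
        ≡⟨ cong (inside v ∧_) (star-sum G star xorMonoid (λ e _ → not ⌊ c e ≟ m ⌋)) ⟩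
      inside v ∧ (not ⌊ c (proj₁ (h 0F)) ≟ m ⌋
        xor (not ⌊ c (proj₁ (h 1F)) ≟ m ⌋ xor not ⌊ c (proj₁ (h 2F)) ≟ m ⌋))
        ≡⟨ cong (inside v ∧_) (cong₂ _xor_ (avoid 0F) (cong₂ _xor_ (avoid 1F) (avoid 2F))) ⟩
      inside v ∧ (not ⌊ 0F ≟ m ⌋ xor (not ⌊ 1F ≟ m ⌋ xor not ⌊ 2F ≟ m ⌋))
        ≡⟨ cong (inside v ∧_) (twoColors m) ⟩
      inside v ∧ false
        ≡⟨ ∧-zeroʳ (inside v) ⟩
      false ∎
      where
      open ≡-Reasoning
      open ColoredStar (coloredStar v)
      at-end : ∀ e i → avoiding m e ≡ inside (end G e i) ∧ not ⌊ c e ≟ m ⌋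
      at-end e zero       = refl
      at-end e (suc zero) = cong (λ x → ⌊ x ≟ κ ⌋ ∧ not ⌊ c e ≟ m ⌋) (component-edge e)
      avoid : ∀ i → not ⌊ c (proj₁ (h i)) ≟ m ⌋ ≡ not ⌊ i ≟ m ⌋
      avoid i = cong (λ x → not ⌊ x ≟ m ⌋) (color i)
      twoColors : ∀ m → not ⌊ 0F ≟ m ⌋ xor (not ⌊ 1F ≟ m ⌋ xor not ⌊ 2F ≟ m ⌋) ≡ false
      twoColors 0F = refl
      twoColors 1F = refl
      twoColors 2F = refl

    -- Every edge avoids exactly two of the three colours.
    signSums-cancel :
      signSum G σ (avoiding 0F) xor (signSum G σ (avoiding 1F) xor signSum G σ (avoiding 2F)) ≡ false
    signSums-cancel = begin
      ⊕.sum (φ 0F) xor (⊕.sum (φ 1F) xor ⊕.sum (φ 2F))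
        ≡⟨ cong (⊕.sum (φ 0F) xor_) (⊕.∑-distrib-+ (φ 1F) (φ 2F)) ⟨
      ⊕.sum (φ 0F) xor ⊕.sum (λ e → φ 1F e xor φ 2F e)
        ≡⟨ ⊕.∑-distrib-+ (φ 0F) (λ e → φ 1F e xor φ 2F e) ⟨
      ⊕.sum (λ e → φ 0F e xor (φ 1F e xor φ 2F e))
        ≡⟨ sum-false {nE G} (λ e → cancel (inside (end G e zero)) (c e) (isNegative (σ e))) ⟩
      false ∎
      where
      open ≡-Reasoning
      φ : Fin 3 → E → Bool
      φ m e = avoiding m e ∧ isNegative (σ e)
      cancel : ∀ w x s → ((w ∧ not ⌊ x ≟ 0F ⌋) ∧ s) xor
        (((w ∧ not ⌊ x ≟ 1F ⌋) ∧ s) xor ((w ∧ not ⌊ x ≟ 2F ⌋) ∧ s)) ≡ false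
      cancel false x  s = refl
      cancel true  0F s = xor-same s
      cancel true  1F s = xor-same s
      cancel true  2F s = trans (cong (s xor_) (xor-identityʳ s)) (xor-same s)

    abstract
      -- Three bits with sum 0 cannot all be 1.
      evenPair : ∃[ m ] signSum G σ (avoiding m) ≡ false
      evenPair with signSum G σ (avoiding 0F) in p | signSum G σ (avoiding 1F) in q
        | signSum G σ (avoiding 2F) in r | signSums-cancel
      ... | false | _     | _     | _ = 0F , p
      ... | true  | false | _     | _ = 1F , q
      ... | true  | true  | false | _ = 2F , r

    -- The circuits of two colour classes have even length.
    evenSubset-count : ∀ m Y → EvenDegrees G Y → (∀ e → Y e ≡ true → c e ≢ m) → ⊕.sum Y ≡ false
    evenSubset-count m Y even misses = begin
      ⊕.sum Y
        ≡⟨ ⊕.sum-cong {nE G} (λ e → splitColors m (c e) (Y e) (misses e)) ⟩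
      ⊕.sum (λ e → class (next m) e xor class (next (next m)) e)
        ≡⟨ ⊕.∑-distrib-+ (class (next m)) (class (next (next m))) ⟩
      ⊕.sum (class (next m)) xor ⊕.sum (class (next (next m)))
        ≡⟨ cong (_xor ⊕.sum (class (next (next m))))
             (doubledCounts-parity (class (next m)) (class (next (next m))) equalCounts) ⟩
      ⊕.sum (class (next (next m))) xor ⊕.sum (class (next (next m)))
        ≡⟨ xor-same (⊕.sum (class (next (next m)))) ⟩
      false ∎
      where
      open ≡-Reasoning
      class : Fin 3 → E → Bool
      class i e = ⌊ c e ≟ i ⌋ ∧ Y e
      Y-at : V → Fin 3 → Bool
      Y-at v i = Y (proj₁ (ColoredStar.h (coloredStar v) i))
      class-at : ∀ i v → ℕΣ.at G v (λ e _ → bit (class i e)) ≡ bit (Y-at v i)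
      class-at i v = trans (star-sum G star ℕ.+-0-commutativeMonoid (λ e _ → bit (class i e)))
        (trans (cong₂ ℕ._+_ (known 0F) (cong₂ ℕ._+_ (known 1F) (known 2F))) (collapse i))
        where
        open ColoredStar (coloredStar v)
        known : ∀ j → bit (class i (proj₁ (h j))) ≡ bit (⌊ j ≟ i ⌋ ∧ Y-at v j)
        known j = cong (λ x → bit (⌊ x ≟ i ⌋ ∧ Y-at v j)) (color j)
        collapse : ∀ i → bit (⌊ 0F ≟ i ⌋ ∧ Y-at v 0F) ℕ.+
          (bit (⌊ 1F ≟ i ⌋ ∧ Y-at v 1F) ℕ.+ bit (⌊ 2F ≟ i ⌋ ∧ Y-at v 2F)) ≡ bit (Y-at v i)
        collapse 0F = ℕ.+-identityʳ _
        collapse 1F = ℕ.+-identityʳ _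
        collapse 2F = refl
      -- `Y` has even degree at `v` and misses colour `m`, so it contains both of the other two
      -- half-edges or neither. Hence both colour classes of `Y` have the same size.
      balanced-at : ∀ v → Y-at v (next m) ≡ Y-at v (next (next m))
      balanced-at v = othersEqual m (Y-at v) (even-star G even star) (¬-not λ y → misses _ y (color m))
        where open ColoredStar (coloredStar v)
      equalCounts : ℕΣ.sum (λ e → bit (class (next m) e) ℕ.+ bit (class (next m) e)) ≡
        ℕΣ.sum (λ e → bit (class (next (next m)) e) ℕ.+ bit (class (next (next m)) e))
      equalCounts = trans (sym (ℕΣ.handshake G (λ e _ → bit (class (next m) e))))
        (trans (ℕΣ.sum-cong {nV G} (λ v → trans (class-at (next m) v)
          (trans (cong bit (balanced-at v)) (sym (class-at (next (next m)) v)))))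
        (ℕΣ.handshake G (λ e _ → bit (class (next (next m)) e))))

    omitted : Fin 3
    omitted = proj₁ evenPair

    module _ (noBarbell : ¬ LongBarbell G σ) where

      -- `p v` will be the common sign of the two half-edges at `v` that avoid the omitted colour.
      -- An obstruction `Y` has an odd number of positive edges but even size, hence an odd number
      -- of negative edges.
      switching : Σ[ p ∈ (V → Bool) ] ∀ e → avoiding omitted e ≡ true →
        p (end G e zero) xor p (end G e (suc zero)) ≡ not (isNegative (σ e))
      switching with balancedOrOddEvenSubset G (avoiding omitted) (λ e → not (isNegative (σ e)))
      ... | inj₁ balanced = balanced
      ... | inj₂ (Y , even , Y⊆X , odd) = contradiction
        (oddEvenSubset⇒barbell G σ cubic {κ} (avoiding-even omitted) (proj₂ evenPair)
          (avoiding-within omitted) even signSum-odd Y⊆X)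
        noBarbell
        where
        open ≡-Reasoning
        complement : ∀ y s → y ∧ s ≡ y xor (y ∧ not s)
        complement false s     = refl
        complement true  false = refl
        complement true  true  = refl
        signSum-odd : signSum G σ Y ≡ true
        signSum-odd = begin
          ⊕.sum (λ e → Y e ∧ isNegative (σ e))
            ≡⟨ ⊕.sum-cong {nE G} (λ e → complement (Y e) (isNegative (σ e))) ⟩
          ⊕.sum (λ e → Y e xor (Y e ∧ not (isNegative (σ e))))
            ≡⟨ ⊕.∑-distrib-+ Y _ ⟩
          ⊕.sum Y xor ⊕.sum (λ e → Y e ∧ not (isNegative (σ e)))
            ≡⟨ cong₂ _xor_ (evenSubset-count omitted Y even
                 (λ e y → avoiding-color omitted e (Y⊆X e y))) odd ⟩
          true ∎

  -- At each vertex, the two edges of value 1 carry the same sign and add up to 2 or -2. The omitted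
  -- colour contributes 2 or -2 as well, so the total is 0, 4 or -4.
  flow : ¬ LongBarbell G σ → HasNZℤ₄Flow G σ
  flow noBarbell = τ , f , orientation , nonzero , conserved
    where
    m : V → Fin 3
    m κ = omitted κ
    p : V → V → Bool
    p κ = proj₁ (switching κ noBarbell)
    componentOf : E → V
    componentOf e = component (end G e zero)
    sign : Bool → Sign
    sign false = pos
    sign true  = neg
    -- Any orientation will do on edges of value 2, since 2 is its own negative modulo 4.
    arbitrary : Sign → Fin 2 → Sign
    arbitrary s zero       = pos
    arbitrary s (suc zero) = negate s
    -- The component is a parameter so that, at a vertex, the component of the edge can be replaced
    -- by that of the vertex.
    halfSign : ∀ κ e → Dec (c e ≡ m κ) → Fin 2 → Sign
    halfSign κ e (yes _) i = arbitrary (σ e) i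
    halfSign κ e (no _)  i = sign (p κ (end G e i))
    amount : ∀ {κ e} → Dec (c e ≡ m κ) → Fin 4
    amount (yes _) = 2F
    amount (no _)  = 1F
    τ : HalfSign G
    τ e = halfSign (componentOf e) e (c e ≟ m (componentOf e))
    f : E → Fin 4
    f e = amount {componentOf e} {e} (c e ≟ m (componentOf e))
    orientation : IsOrientation G σ τ
    orientation e = oriented (c e ≟ m κ)
      where
      κ : V
      κ = componentOf e
      isInside : inside κ (end G e zero) ≡ true
      isInside with component (end G e zero) ≟ κ
      ... | yes _ = refl
      ... | no ¬p = contradiction refl ¬p
      avoids : c e ≢ m κ → not ⌊ c e ≟ m κ ⌋ ≡ true
      avoids c≢m with c e ≟ m κ
      ... | yes q = contradiction q c≢m
      ... | no _  = refl
      signs : ∀ x y s → x xor y ≡ not (isNegative s) → sign x · sign y ≡ negate s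
      signs true  true  neg _ = refl
      signs true  false pos _ = refl
      signs false true  pos _ = refl
      signs false false neg _ = refl
      oriented : ∀ d → halfSign κ e d zero · halfSign κ e d (suc zero) ≡ negate (σ e)
      oriented (yes _)  = refl
      oriented (no c≢m) = signs (p κ (end G e zero)) (p κ (end G e (suc zero))) (σ e)
        (proj₂ (switching κ noBarbell) e (cong₂ _∧_ isInside (avoids c≢m)))
    nonzero : ∀ e → f e ≢ zero
    nonzero e = positive (c e ≟ m (componentOf e))
      where
      positive : ∀ d → amount {componentOf e} {e} d ≢ zero
      positive (yes _) ()
      positive (no _)  ()
    conserved : ∀ v → 4 ℕ.∣ ∣ ∂ G τ (λ e → + toℕ (f e)) v ∣
    conserved v = subst (λ z → 4 ℕ.∣ ∣ z ∣) (sym (∂-star G τ (λ e → + toℕ (f e)) star))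
      (subst₂ (λ x y → 4 ℕ.∣ ∣ x ℤ.+ y ∣) (sym (term≡ 0F))
        (sym (cong₂ ℤ._+_ (term≡ 1F) (term≡ 2F))) (balance (m κ)))
      where
      open ColoredStar (coloredStar v)
      κ : V
      κ = component v
      x : Bool
      x = p κ v
      h-end : ∀ i → endOf G (h i) ≡ v
      h-end 0F = star-end G star (here refl)
      h-end 1F = star-end G star (there (here refl))
      h-end 2F = star-end G star (there (there (here refl)))
      termIn : V → HalfEdge G → ℤ
      termIn κ (e , i) = toℤ (halfSign κ e (c e ≟ m κ) i) ℤ.* + toℕ (amount {κ} {e} (c e ≟ m κ))
      free : HalfEdge G → Sign
      free (e , i) = arbitrary (σ e) i
      contribution : Bool → Sign → ℤ
      contribution true  s = toℤ s ℤ.* + 2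
      contribution false s = toℤ (sign x) ℤ.* + 1
      component-of-half : ∀ h → endOf G h ≡ v → componentOf (proj₁ h) ≡ κ
      component-of-half (e , zero)     refl = refl
      component-of-half (e , suc zero) refl = component-edge e
      contributes : ∀ h → endOf G h ≡ v → termIn κ h ≡ contribution ⌊ c (proj₁ h) ≟ m κ ⌋ (free h)
      contributes (e , i) refl with c e ≟ m κ
      ... | yes _ = refl
      ... | no _  = refl
      term≡ : ∀ i → termIn (componentOf (proj₁ (h i))) (h i) ≡ contribution ⌊ i ≟ m κ ⌋ (free (h i))
      term≡ i = trans (cong (λ κ′ → termIn κ′ (h i)) (component-of-half (h i) (h-end i)))
        (trans (contributes (h i) (h-end i)) (cong (λ j → contribution ⌊ j ≟ m κ ⌋ (free (h i))) (color i)))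
      balance : ∀ j → 4 ℕ.∣ ∣ contribution ⌊ 0F ≟ j ⌋ (free (h 0F)) ℤ.+
        (contribution ⌊ 1F ≟ j ⌋ (free (h 1F)) ℤ.+ contribution ⌊ 2F ≟ j ⌋ (free (h 2F))) ∣
      balance 0F with x | free (h 0F)
      ... | true  | pos = ℕ.divides 0 refl
      ... | true  | neg = ℕ.divides 1 refl
      ... | false | pos = ℕ.divides 1 refl
      ... | false | neg = ℕ.divides 0 refl
      balance 1F with x | free (h 1F)
      ... | true  | pos = ℕ.divides 0 refl
      ... | true  | neg = ℕ.divides 1 refl
      ... | false | pos = ℕ.divides 1 refl
      ... | false | neg = ℕ.divides 0 refl
      balance 2F with x | free (h 2F)
      ... | true  | pos = ℕ.divides 0 refl
      ... | true  | neg = ℕ.divides 1 refl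
      ... | false | pos = ℕ.divides 1 refl
      ... | false | neg = ℕ.divides 0 refl

theorem3p13 : (G : Graph) (σ : Signature G) → Cubic G → FlowAdmissible G σ →
    ¬ LongBarbell G σ → (HasNZℤ₄Flow G σ ⇔ ThreeEdgeColorable G)
theorem3p13 G σ cubic _ noBarbell = mk⇔ (flow⇒colorable G σ cubic noBarbell)
  λ { (c , proper) → Colored.flow G σ cubic c proper noBarbell }
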